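{- Let $m,n,k\in\mathbb{N}=\{0,1,2,\ldots\}$ and $\xi=m\alpha_1+n\alpha_2+k\alpha_3$. Throughout, for an integer $i$ put $t=m+n+k-i$. \begin{enumerate} \item If $m\geq n$ and $k\geq n$, then $\wp_q(\xi)=\sum_{i=m+k-n}^{m+n+k}(L+1)(L+(t\bmod 2)+1)q^i$, where $L=\min\{\lfloor t/2\rfloor,\ n-\lceil t/2\rceil\}$. \item If $m\geq n\geq k$, then $\wp_q(\xi)=\sum_{i=m}^{m+n+k}c_iq^i$, where \[c_i=\begin{cases}\frac{(L+1)(2k-2F_2+L+2)}{2} & \text{if } J<0,\\[2pt] \frac{(L+1)(L+2)-F_2(F_2+1)-k(k-1)}{2}+F_2k+kL-F_2L+(k-F_2)(t\bmod 2) & \text{if } 0\leq J\leq L,\\[2pt] (L+1)(L+(t\bmod 2)+1) & \text{if } J>L,\end{cases}\] with $F_2=\min\{\lfloor t/2\rfloor,k\}$, $J=k-F_2-(t\bmod 2)$, $F_1=\max\{t-n,0\}$, $L=F_2-F_1$. \item If $k\geq n\geq m$, then $\wp_q(\xi)=\sum_{i=k}^{m+n+k}c_iq^i$, where \[c_i=\begin{cases}\frac{(L+1)(2m-2F_2+L+2)}{2} & \text{if } J<0,\\[2pt] \frac{(L+1)(L+2)-F_2(F_2+1)-m(m-1)}{2}+F_2m+mL-F_2L+(m-F_2)(t\bmod 2) & \text{if } 0\leq J\leq L,\\[2pt] (L+1)(L+(t\bmod 2)+1) & \text{if } J>L,\end{cases}\] with $F_2=\min\{\lfloor t/2\rfloor,m\}$,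 $J=m-F_2-(t\bmod 2)$, $F_1=\max\{t-n,0\}$, $L=F_2-F_1$. \item If $n\geq m\geq k$, then $\wp_q(\xi)=\sum_{i=n}^{m+n+k}c_iq^i$, where $c_i=S_1-S_2+F_2-F_1+1$ with \[S_1=\begin{cases}(t-F_2)(F_2+1) & \text{if } t-m<0,\\ \frac{(t-m)(t-m+1)+F_1(F_1-1)-2F_2(F_2+1)+2m(t-m-F_1+1)+2t(F_2-t+m)}{2} & \text{if } 0\leq t-m\leq F_2,\end{cases}\] \[S_2=\begin{cases}(t-k)(t-k-F_1+1)-\frac{(t-k)(t-k+1)-F_1(F_1-1)}{2} & \text{if } 0\leq t-k\leq F_2,\\ (t-k)(F_2-F_1+1)-\frac{F_2(F_2+1)-F_1(F_1-1)}{2} & \text{if } t-k>F_2,\\ 0 & \text{if } t-k<0,\end{cases}\] and $F_1=\max\{0,t-\min\{m+k,n\}\}$, $F_2=\min\{\lfloor t/2\rfloor,k\}$. \item If $n\geq k\geq m$, then $\wp_q(\xi)=\sum_{i=n}^{m+n+k}c_iq^i$, where $c_i=S_1-S_2+F_2-F_1+1$ with \[S_1=\begin{cases}(t-F_2)(F_2+1) & \text{if } t-k<0,\\ \frac{(t-k)(t-k+1)+F_1(F_1-1)-2F_2(F_2+1)+2k(t-k-F_1+1)+2t(F_2-t+k)}{2} & \text{if } 0\leq t-k\leq F_2,\end{cases}\] \[S_2=\begin{cases}(t-m)(t-m-F_1+1)-\frac{(t-m)(t-m+1)-F_1(F_1-1)}{2} & \text{if } 0\leq t-m\leq F_2,\\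 (t-m)(F_2-F_1+1)-\frac{F_2(F_2+1)-F_1(F_1-1)}{2} & \text{if } t-m>F_2,\\ 0 & \text{if } t-m<0,\end{cases}\] and $F_1=\max\{0,t-\min\{m+k,n\}\}$, $F_2=\min\{\lfloor t/2\rfloor,m\}$. \end{enumerate}
   Context: This concerns the Lie algebra $\mathfrak{sl}_4(\mathbb{C})$ with simple roots $\alpha_1,\alpha_2,\alpha_3$ (linearly independent; $\alpha_i=e_i-e_{i+1}$ in $\mathbb{R}^4$) and positive roots $\Phi^+=\{\alpha_1,\alpha_2,\alpha_3,\alpha_1+\alpha_2,\alpha_2+\alpha_3,\alpha_1+\alpha_2+\alpha_3\}$. For a vector $\xi$ in the real span of the simple roots, the $q$-analog of Kostant's partition function is the polynomial $\wp_q(\xi)=\sum_{i\geq 0}c_iq^i$, where $c_i$ is the number of ways to write $\xi$ as a sum of exactly $i$ positive roots, i.e. the number of tuples $(a_\beta)_{\beta\in\Phi^+}\in\mathbb{N}^6$ with $\sum_\beta a_\beta\beta=\xi$ and $\sum_\beta a_\beta=i$. $\lfloor\cdot\rfloor,\lceil\cdot\rceil$ are floor and ceiling, and $t\bmod 2\in\{0,1\}$. -}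

module Defs where

open import Data.Nat as ℕ using (ℕ; zero; suc)
open import Data.Integer as ℤ using (ℤ; +_; _+_; _-_; _*_; _⊓_; _⊔_)
open import Data.Integer.DivMod using (_/ℕ_; _%ℕ_)
open import Data.Bool using (Bool; true; false; if_then_else_; _∧_)
open import Data.Fin using (Fin)
open import Data.Vec as Vec using (Vec; []; _∷_)
open import Data.Vec.Properties using (≡-dec)
open import Data.List as List using (List; []; _∷_; length; filter; concatMap; upTo)
open import Data.Product using (_×_)
open import Relation.Nullary.Decidable using (_×-dec_)
open import Relation.Binary.PropositionalEquality using (_≡_)

-- Positive roots of sl_4, written in coordinates w.r.t. the simple roots
-- α₁, α₂, α₃ (which are linearly independent, so a vector in their span
-- is determined by these coordinates).

posRoot : Fin 6 → Vec ℕ 3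
posRoot i = Vec.lookup
  ( (1 ∷ 0 ∷ 0 ∷ [])
  ∷ (0 ∷ 1 ∷ 0 ∷ [])
  ∷ (0 ∷ 0 ∷ 1 ∷ [])
  ∷ (1 ∷ 1 ∷ 0 ∷ [])
  ∷ (0 ∷ 1 ∷ 1 ∷ [])
  ∷ (1 ∷ 1 ∷ 1 ∷ [])
  ∷ []) i

weight : Vec ℕ 6 → Vec ℕ 3
weight a = Vec.foldr _ (Vec.zipWith ℕ._+_) (0 ∷ 0 ∷ 0 ∷ [])
  (Vec.zipWith (λ c β → Vec.map (c ℕ.*_) β) a (Vec.tabulate posRoot))

size : Vec ℕ 6 → ℕ
size = Vec.sum

xi : ℕ → ℕ → ℕ → Vec ℕ 3
xi m n k = m ∷ n ∷ k ∷ []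

boxed : (B : ℕ) → (d : ℕ) → List (Vec ℕ d)
boxed B zero = [] ∷ []
boxed B (suc d) = concatMap (λ x → List.map (x ∷_) (boxed B d)) (upTo (suc B))

IsSol : ℕ → ℕ → ℕ → ℕ → Vec ℕ 6 → Set
IsSol m n k i a = (weight a ≡ xi m n k) × (size a ≡ i)

-- c_i = coefficient of q^i in ℘_q(ξ): the number of tuples a ∈ ℕ^6 with
-- Σ a_β β = ξ and Σ a_β = i.  Every such tuple has all entries
-- ≤ m+n+k (each positive root has coordinate sum ≥ 1), so the count is
-- taken over the finite box [0, m+n+k]^6.
kpfCoeff : ℕ → ℕ → ℕ → ℕ → ℕ
kpfCoeff m n k i =
  length (filter (λ a → ≡-dec ℕ._≟_ (weight a) (xi m n k) ×-dec (size a ℕ.≟ i))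
                 (boxed (m ℕ.+ n ℕ.+ k) 6))

rangeCoeff : ℕ → ℕ → (ℕ → ℤ) → ℕ → ℤ
rangeCoeff lo hi c i = if (lo ℕ.≤ᵇ i) ∧ (i ℕ.≤ᵇ hi) then c i else + 0

fl2 : ℤ → ℤ
fl2 t = t /ℕ 2

ce2 : ℤ → ℤ
ce2 t = (t + + 1) /ℕ 2

md2 : ℤ → ℤ
md2 t = + (t %ℕ 2)

half : ℤ → ℤ
half x = x /ℕ 2

infix 4 _<ᶻ_ _≤ᶻ_

_<ᶻ_ : ℤ → ℤ → Bool
x <ᶻ y = (x + + 1) ℤ.≤ᵇ y

_≤ᶻ_ : ℤ → ℤ → Bool
x ≤ᶻ y = x ℤ.≤ᵇ y

tOf : ℕ → ℕ → ℕ → ℕ → ℤ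
tOf m n k i = + (m ℕ.+ n ℕ.+ k) - + i

coeff1 : ℕ → ℤ → ℤ
coeff1 n t =
  let L = fl2 t ⊓ (+ n - ce2 t)
  in (L + + 1) * (L + md2 t + + 1)

-- Parts 2 and 3 coefficient; s = k in part 2, s = m in part 3.
coeff23 : ℕ → ℕ → ℤ → ℤ
coeff23 s' n t =
  let s  = + s'
      F₂ = fl2 t ⊓ s
      J  = s - F₂ - md2 t
      F₁ = (t - + n) ⊔ + 0
      L  = F₂ - F₁
  in if J <ᶻ + 0
     then half ((L + + 1) * (+ 2 * s - + 2 * F₂ + L + + 2))
     else if J ≤ᶻ L
     then half ((L + + 1) * (L + + 2) - F₂ * (F₂ + + 1) - s * (s - + 1))
          + F₂ * s + s * L - F₂ * L + (s - F₂) * md2 t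
     else (L + + 1) * (L + md2 t + + 1)

-- Parts 4 and 5 coefficient: u is the variable in S₁ (m in part 4,
-- k in part 5), v the one in F₂ and S₂ (k in part 4, m in part 5).
-- The cases listed in the paper for S₁ are t-u<0 and 0≤t-u≤F₂; we use
-- the second formula whenever t-u ≥ 0 (t-u > F₂ never occurs for i in
-- the range of the sum).
coeff45 : ℕ → ℕ → ℕ → ℕ → ℕ → ℤ → ℤ
coeff45 m n k u' v' t =
  let u  = + u'
      v  = + v'
      F₂ = fl2 t ⊓ v
      F₁ = + 0 ⊔ (t - ((+ m + + k) ⊓ + n))
      S₁ = if (t - u) <ᶻ + 0
           then (t - F₂) * (F₂ + + 1)
           else half ((t - u) * (t - u + + 1) + F₁ * (F₁ - + 1)
                      - + 2 * F₂ * (F₂ + + 1) + + 2 * u * (t - u - F₁ + + 1)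
                      + + 2 * t * (F₂ - t + u))
      S₂ = if (t - v) <ᶻ + 0
           then + 0
           else if (t - v) ≤ᶻ F₂
           then (t - v) * (t - v - F₁ + + 1)
                - half ((t - v) * (t - v + + 1) - F₁ * (F₁ - + 1))
           else (t - v) * (F₂ - F₁ + + 1)
                - half (F₂ * (F₂ + + 1) - F₁ * (F₁ - + 1))
  in S₁ - S₂ + F₂ - F₁ + + 1

-- Write a solution as (a₁, a₂, a₃, x, y, z), where x, y, z are the multiplicities of α₁+α₂,
-- α₂+α₃, α₁+α₂+α₃. The multiplicities of the simple roots are then forced, and the solution uses
-- m + n + k − x − y − 2z roots; so, with t = m + n + k − i, the coefficient c_i counts the triples
-- with x + y + 2z = t, x + z ≤ m, x + y + z ≤ n and y + z ≤ k. For fixed z the admissible x form an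
-- interval, whose length is piecewise affine in z, with slopes 0, −1, −2 on three consecutive
-- ranges. Summing these arithmetic progressions, in each case according to the position of ⌊t/2⌋,
-- t − m and t − k, gives parts 1, 2 and 4; exchanging α₁ and α₃ (m ↔ k) gives parts 3 and 5.

module Submission where

module FiniteSums where

  open import Data.Nat
  open import Data.Nat.Properties
  open import Data.Bool using (Bool; true; false; T; _∧_)
  open import Data.Unit using (tt)
  open import Data.Empty using (⊥-elim)
  open import Relation.Binary.PropositionalEquality
  open import Relation.Nullary using (¬_; yes; no)
  open import Data.Nat.Tactic.RingSolver

  χ : Bool → ℕ
  χ true = 1
  χ false = 0

  χ-∧ : ∀ a b → χ (a ∧ b) ≡ χ a * χ b
  χ-∧ true b = sym (+-identityʳ (χ b))
  χ-∧ false b = refl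

  χ-true : ∀ {b} → T b → χ b ≡ 1
  χ-true {true} _ = refl

  χ-false : ∀ {b} → ¬ T b → χ b ≡ 0
  χ-false {true} h = ⊥-elim (h tt)
  χ-false {false} _ = refl

  χ-≤ᵇ : ∀ {m n} → m ≤ n → χ (m ≤ᵇ n) ≡ 1
  χ-≤ᵇ p = χ-true (≤⇒≤ᵇ p)

  χ-≰ᵇ : ∀ {m n} → n < m → χ (m ≤ᵇ n) ≡ 0
  χ-≰ᵇ {m} {n} p = χ-false (λ t → <⇒≱ p (≤ᵇ⇒≤ m n t))

  χ-≡ᵇ : ∀ {m n} → m ≡ n → χ (m ≡ᵇ n) ≡ 1
  χ-≡ᵇ {m} {n} p = χ-true (≡⇒≡ᵇ m n p)

  χ-≢ᵇ : ∀ {m n} → m ≢ n → χ (m ≡ᵇ n) ≡ 0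
  χ-≢ᵇ {m} {n} p = χ-false (λ t → p (≡ᵇ⇒≡ m n t))

  χ-cong-⇔ : ∀ {b c} → (T b → T c) → (T c → T b) → χ b ≡ χ c
  χ-cong-⇔ {true} {true} f g = refl
  χ-cong-⇔ {true} {false} f g with f tt
  ... | ()
  χ-cong-⇔ {false} {true} f g with g tt
  ... | ()
  χ-cong-⇔ {false} {false} f g = refl

  χ-≡ᵇ-⇔ : ∀ {a b c d} → (a ≡ b → c ≡ d) → (c ≡ d → a ≡ b) → χ (a ≡ᵇ b) ≡ χ (c ≡ᵇ d)
  χ-≡ᵇ-⇔ {a} {b} {c} {d} f g =
    χ-cong-⇔ (λ t → ≡⇒≡ᵇ c d (f (≡ᵇ⇒≡ a b t))) (λ t → ≡⇒≡ᵇ a b (g (≡ᵇ⇒≡ c d t)))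

  ∑ : ℕ → (ℕ → ℕ) → ℕ
  ∑ zero f = 0
  ∑ (suc N) f = f 0 + ∑ N (λ j → f (suc j))

  ∑-cong : ∀ N {f g : ℕ → ℕ} → (∀ j → j < N → f j ≡ g j) → ∑ N f ≡ ∑ N g
  ∑-cong zero h = refl
  ∑-cong (suc N) h = cong₂ _+_ (h 0 z<s) (∑-cong N (λ j j<N → h (suc j) (s<s j<N)))

  ∑-zero : ∀ N {f : ℕ → ℕ} → (∀ j → j < N → f j ≡ 0) → ∑ N f ≡ 0
  ∑-zero zero h = refl
  ∑-zero (suc N) h = cong₂ _+_ (h 0 z<s) (∑-zero N (λ j j<N → h (suc j) (s<s j<N)))

  ∑-distrib-+ : ∀ N (f g : ℕ → ℕ) → ∑ N (λ j → f j + g j) ≡ ∑ N f + ∑ N g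
  ∑-distrib-+ zero f g = refl
  ∑-distrib-+ (suc N) f g rewrite ∑-distrib-+ N (λ j → f (suc j)) (λ j → g (suc j)) =
    interchange (f 0) (g 0) (∑ N (λ j → f (suc j))) (∑ N (λ j → g (suc j)))
    where
    interchange : ∀ a b c d → a + b + (c + d) ≡ a + c + (b + d)
    interchange = solve-∀

  ∑-*ˡ : ∀ N c (f : ℕ → ℕ) → ∑ N (λ j → c * f j) ≡ c * ∑ N f
  ∑-*ˡ zero c f = sym (*-zeroʳ c)
  ∑-*ˡ (suc N) c f rewrite ∑-*ˡ N c (λ j → f (suc j)) = sym (*-distribˡ-+ c (f 0) _)

  ∑-comm : ∀ N M (f : ℕ → ℕ → ℕ) → ∑ N (λ x → ∑ M (λ y → f x y)) ≡ ∑ M (λ y → ∑ N (λ x → f x y))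
  ∑-comm zero M f = sym (∑-zero M (λ _ _ → refl))
  ∑-comm (suc N) M f = begin
    ∑ M (λ y → f 0 y) + ∑ N (λ x → ∑ M (λ y → f (suc x) y))
      ≡⟨ cong (∑ M (λ y → f 0 y) +_) (∑-comm N M (λ x y → f (suc x) y)) ⟩
    ∑ M (λ y → f 0 y) + ∑ M (λ y → ∑ N (λ x → f (suc x) y))
      ≡⟨ sym (∑-distrib-+ M (λ y → f 0 y) (λ y → ∑ N (λ x → f (suc x) y))) ⟩
    ∑ M (λ y → f 0 y + ∑ N (λ x → f (suc x) y)) ∎
    where open ≡-Reasoning

  ∑-split : ∀ a b (f : ℕ → ℕ) → ∑ (a + b) f ≡ ∑ a f + ∑ b (λ j → f (a + j))
  ∑-split zero b f = refl
  ∑-split (suc a) b f rewrite ∑-split a b (λ j → f (suc j)) = sym (+-assoc (f 0) _ _)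

  ∑-split-at : ∀ a c e (f : ℕ → ℕ) → a ≤ c → c ≤ e →
    ∑ (e ∸ a) (λ j → f (a + j)) ≡ ∑ (c ∸ a) (λ j → f (a + j)) + ∑ (e ∸ c) (λ j → f (c + j))
  ∑-split-at a c e f a≤c c≤e = begin
    ∑ (e ∸ a) (λ j → f (a + j))
      ≡⟨ cong (λ N → ∑ N (λ j → f (a + j))) (sym lengths) ⟩
    ∑ ((c ∸ a) + (e ∸ c)) (λ j → f (a + j))
      ≡⟨ ∑-split (c ∸ a) (e ∸ c) (λ j → f (a + j)) ⟩
    ∑ (c ∸ a) (λ j → f (a + j)) + ∑ (e ∸ c) (λ j → f (a + ((c ∸ a) + j)))
      ≡⟨ cong (∑ (c ∸ a) (λ j → f (a + j)) +_) (∑-cong (e ∸ c) (λ j _ → cong f (shift j))) ⟩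
    ∑ (c ∸ a) (λ j → f (a + j)) + ∑ (e ∸ c) (λ j → f (c + j)) ∎
    where
    open ≡-Reasoning
    shift : ∀ j → a + ((c ∸ a) + j) ≡ c + j
    shift j = trans (sym (+-assoc a (c ∸ a) j)) (cong (_+ j) (m+[n∸m]≡n a≤c))
    lengths : (c ∸ a) + (e ∸ c) ≡ e ∸ a
    lengths = +-cancelˡ-≡ a _ _ (begin
      a + ((c ∸ a) + (e ∸ c))   ≡⟨ sym (+-assoc a (c ∸ a) (e ∸ c)) ⟩
      a + (c ∸ a) + (e ∸ c)     ≡⟨ cong (_+ (e ∸ c)) (m+[n∸m]≡n a≤c) ⟩
      c + (e ∸ c)               ≡⟨ m+[n∸m]≡n c≤e ⟩
      e                         ≡⟨ sym (m+[n∸m]≡n (≤-trans a≤c c≤e)) ⟩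
      a + (e ∸ a)               ∎)

  ∑-const : ∀ N c → ∑ N (λ _ → c) ≡ N * c
  ∑-const zero c = refl
  ∑-const (suc N) c = cong (c +_) (∑-const N c)

  ∑-window : ∀ N a l (f : ℕ → ℕ) → a + l ≤ N →
    (∀ j → j < a → f j ≡ 0) → (∀ j → a + l ≤ j → f j ≡ 0) →
    ∑ N f ≡ ∑ l (λ j → f (a + j))
  ∑-window N a l f a+l≤N below above = begin
    ∑ N f
      ≡⟨ cong (λ x → ∑ x f) (sym N≡a+[l+r]) ⟩
    ∑ (a + (l + r)) f
      ≡⟨ ∑-split a (l + r) f ⟩
    ∑ a f + ∑ (l + r) (λ j → f (a + j))
      ≡⟨ cong₂ _+_ (∑-zero a below) (∑-split l r (λ j → f (a + j))) ⟩
    ∑ l (λ j → f (a + j)) + ∑ r (λ j → f (a + (l + j)))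
      ≡⟨ cong (∑ l (λ j → f (a + j)) +_) (∑-zero r (λ j _ → above (a + (l + j)) (a+l≤a+[l+j] j))) ⟩
    ∑ l (λ j → f (a + j)) + 0
      ≡⟨ +-identityʳ _ ⟩
    ∑ l (λ j → f (a + j)) ∎
    where
    open ≡-Reasoning
    r = N ∸ (a + l)
    N≡a+[l+r] : a + (l + r) ≡ N
    N≡a+[l+r] = trans (sym (+-assoc a l r)) (m+[n∸m]≡n a+l≤N)
    a+l≤a+[l+j] : ∀ j → a + l ≤ a + (l + j)
    a+l≤a+[l+j] j = subst (a + l ≤_) (+-assoc a l j) (m≤m+n (a + l) j)

  ∑-select : ∀ N c m (g : ℕ → ℕ) → m < N → ∑ N (λ a → χ (a + c ≡ᵇ m) * g a) ≡ χ (c ≤ᵇ m) * g (m ∸ c)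
  ∑-select N c m g m<N with c ≤? m
  ... | yes c≤m = begin
    ∑ N (λ a → χ (a + c ≡ᵇ m) * g a)
      ≡⟨ ∑-window N (m ∸ c) 1 _ window≤N
           (λ j j<m∸c → cong (_* g j) (χ-≢ᵇ (<⇒≢ (below j j<m∸c))))
           (λ j m∸c<j → cong (_* g j) (χ-≢ᵇ (≢-sym (<⇒≢ (above j m∸c<j))))) ⟩
    χ (m ∸ c + 0 + c ≡ᵇ m) * g (m ∸ c + 0) + 0
      ≡⟨ +-identityʳ _ ⟩
    χ (m ∸ c + 0 + c ≡ᵇ m) * g (m ∸ c + 0)
      ≡⟨ cong (λ x → χ (x + c ≡ᵇ m) * g x) (+-identityʳ (m ∸ c)) ⟩
    χ (m ∸ c + c ≡ᵇ m) * g (m ∸ c)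
      ≡⟨ cong (_* g (m ∸ c)) (trans (χ-≡ᵇ (m∸n+n≡m c≤m)) (sym (χ-≤ᵇ c≤m))) ⟩
    χ (c ≤ᵇ m) * g (m ∸ c) ∎
    where
    open ≡-Reasoning
    window≤N : m ∸ c + 1 ≤ N
    window≤N = subst (_≤ N) (+-comm 1 (m ∸ c)) (≤-trans (s≤s (m∸n≤m m c)) m<N)
    below : ∀ j → j < m ∸ c → j + c < m
    below j j<m∸c = subst (j + c <_) (m∸n+n≡m c≤m) (+-monoˡ-< c j<m∸c)
    above : ∀ j → m ∸ c + 1 ≤ j → m < j + c
    above j h = subst (_< j + c) (m∸n+n≡m c≤m) (+-monoˡ-≤ c (subst (_≤ j) (+-comm (m ∸ c) 1) h))
  ... | no c≰m = begin
    ∑ N (λ a → χ (a + c ≡ᵇ m) * g a)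
      ≡⟨ ∑-zero N (λ j _ → cong (_* g j) (χ-≢ᵇ (λ e → c≰m (subst (c ≤_) e (m≤n+m c j))))) ⟩
    0
      ≡⟨ sym (cong (_* g (m ∸ c)) (χ-≰ᵇ (≰⇒> c≰m))) ⟩
    χ (c ≤ᵇ m) * g (m ∸ c) ∎
    where open ≡-Reasoning

  ∑-interval : ∀ N lo hi → hi < N → ∑ N (λ x → χ (lo ≤ᵇ x) * χ (x ≤ᵇ hi)) ≡ suc hi ∸ lo
  ∑-interval N lo hi hi<N with lo ≤? hi
  ... | yes lo≤hi = begin
    ∑ N (λ x → χ (lo ≤ᵇ x) * χ (x ≤ᵇ hi))
      ≡⟨ ∑-window N lo (suc hi ∸ lo) _ window≤N
           (λ j j<lo → cong (_* χ (j ≤ᵇ hi)) (χ-≰ᵇ j<lo))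
           (λ j h → trans (cong (χ (lo ≤ᵇ j) *_) (χ-≰ᵇ (subst (_≤ j) lo+[1+hi∸lo] h))) (*-zeroʳ (χ (lo ≤ᵇ j)))) ⟩
    ∑ (suc hi ∸ lo) (λ j → χ (lo ≤ᵇ lo + j) * χ (lo + j ≤ᵇ hi))
      ≡⟨ ∑-cong (suc hi ∸ lo) (λ j j< → cong₂ _*_ (χ-≤ᵇ (m≤m+n lo j)) (χ-≤ᵇ (inside j j<))) ⟩
    ∑ (suc hi ∸ lo) (λ _ → 1)
      ≡⟨ trans (∑-const (suc hi ∸ lo) 1) (*-identityʳ (suc hi ∸ lo)) ⟩
    suc hi ∸ lo ∎
    where
    open ≡-Reasoning
    lo+[1+hi∸lo] : lo + (suc hi ∸ lo) ≡ suc hi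
    lo+[1+hi∸lo] = m+[n∸m]≡n (m≤n⇒m≤1+n lo≤hi)
    window≤N : lo + (suc hi ∸ lo) ≤ N
    window≤N = subst (_≤ N) (sym lo+[1+hi∸lo]) hi<N
    inside : ∀ j → j < suc hi ∸ lo → lo + j ≤ hi
    inside j j< = ≤-pred (subst (lo + j <_) lo+[1+hi∸lo] (+-monoʳ-< lo j<))
  ... | no lo≰hi = begin
    ∑ N (λ x → χ (lo ≤ᵇ x) * χ (x ≤ᵇ hi))
      ≡⟨ ∑-zero N (λ j _ → outside j) ⟩
    0
      ≡⟨ sym (m≤n⇒m∸n≡0 (≰⇒> lo≰hi)) ⟩
    suc hi ∸ lo ∎
    where
    open ≡-Reasoning
    outside : ∀ j → χ (lo ≤ᵇ j) * χ (j ≤ᵇ hi) ≡ 0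
    outside j with lo ≤? j
    ... | yes lo≤j = trans (cong (χ (lo ≤ᵇ j) *_) (χ-≰ᵇ (<-≤-trans (≰⇒> lo≰hi) lo≤j))) (*-zeroʳ (χ (lo ≤ᵇ j)))
    ... | no lo≰j = cong (_* χ (j ≤ᵇ hi)) (χ-≰ᵇ (≰⇒> lo≰j))


module Counting where

  open import Data.Nat
  open import Data.Nat.Properties
  open import Data.Bool using (Bool; true; false; _∧_)
  open import Data.Vec using (Vec; []; _∷_)
  open import Data.List as List using (List; []; _∷_; length; filter; concatMap; applyUpTo; _++_)
  open import Data.Vec.Properties using (≡-dec)
  open import Relation.Nullary using (Dec; yes; no)
  open import Relation.Nullary.Decidable using (_×-dec_; does)
  open import Relation.Binary.PropositionalEquality
  open import Data.Nat.Tactic.RingSolver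
  open import Defs
  open FiniteSums

  count : ∀ {A : Set} → (A → Bool) → List A → ℕ
  count p [] = 0
  count p (x ∷ xs) = χ (p x) + count p xs

  length-filter : ∀ {A : Set} {P : A → Set} (P? : ∀ a → Dec (P a)) xs →
    length (filter P? xs) ≡ count (λ a → does (P? a)) xs
  length-filter P? [] = refl
  length-filter P? (x ∷ xs) with does (P? x)
  ... | true = cong suc (length-filter P? xs)
  ... | false = length-filter P? xs

  count-++ : ∀ {A : Set} (p : A → Bool) xs ys → count p (xs ++ ys) ≡ count p xs + count p ys
  count-++ p [] ys = refl
  count-++ p (x ∷ xs) ys rewrite count-++ p xs ys = sym (+-assoc (χ (p x)) _ _)

  count-map : ∀ {A B : Set} (p : B → Bool) (h : A → B) xs →
    count p (List.map h xs) ≡ count (λ a → p (h a)) xs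
  count-map p h [] = refl
  count-map p h (x ∷ xs) = cong (χ (p (h x)) +_) (count-map p h xs)

  count-concatMap : ∀ {A B : Set} (p : B → Bool) (f : A → List B) (g : ℕ → A) N →
    count p (concatMap f (applyUpTo g N)) ≡ ∑ N (λ j → count p (f (g j)))
  count-concatMap p f g zero = refl
  count-concatMap p f g (suc N) =
    trans (count-++ p (f (g 0)) _) (cong (count p (f (g 0)) +_) (count-concatMap p f (λ j → g (suc j)) N))

  ∑box : ∀ B d → (Vec ℕ d → ℕ) → ℕ
  ∑box B zero f = f []
  ∑box B (suc d) f = ∑ (suc B) (λ x → ∑box B d (λ v → f (x ∷ v)))

  count-boxed : ∀ B d (p : Vec ℕ d → Bool) → count p (boxed B d) ≡ ∑box B d (λ v → χ (p v))
  count-boxed B zero p = +-identityʳ (χ (p []))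
  count-boxed B (suc d) p =
    trans (count-concatMap p (λ x → List.map (x ∷_) (boxed B d)) (λ j → j) (suc B))
          (∑-cong (suc B) (λ x _ → trans (count-map p (x ∷_) (boxed B d)) (count-boxed B d (λ v → p (x ∷ v)))))

  solTerm : ℕ → ℕ → ℕ → ℕ → ℕ → ℕ → ℕ → ℕ → ℕ → ℕ → ℕ
  solTerm m n k i a₁ a₂ a₃ x y z =
    χ (a₁ + (x + z) ≡ᵇ m) * (χ (a₂ + (x + (y + z)) ≡ᵇ n) * (χ (a₃ + (y + z) ≡ᵇ k) *
      χ (a₁ + (a₂ + (a₃ + (x + (y + (z + 0))))) ≡ᵇ i)))

  χ-∧⁴ : ∀ b₁ b₂ b₃ b₄ → χ ((b₁ ∧ (b₂ ∧ (b₃ ∧ true))) ∧ b₄) ≡ χ b₁ * (χ b₂ * (χ b₃ * χ b₄))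
  χ-∧⁴ true true true true = refl
  χ-∧⁴ true true true false = refl
  χ-∧⁴ true true false b₄ = refl
  χ-∧⁴ true false b₃ b₄ = refl
  χ-∧⁴ false b₂ b₃ b₄ = refl

  IsSol? : ∀ m n k i a → Dec (IsSol m n k i a)
  IsSol? m n k i a = ≡-dec _≟_ (weight a) (xi m n k) ×-dec (size a ≟ i)

  weight₁ : ∀ a₁ a₂ a₃ x y z → a₁ * 1 + (a₂ * 0 + (a₃ * 0 + (x * 1 + (y * 0 + (z * 1 + 0))))) ≡ a₁ + (x + z)
  weight₁ = solve-∀

  weight₂ : ∀ a₁ a₂ a₃ x y z → a₁ * 0 + (a₂ * 1 + (a₃ * 0 + (x * 1 + (y * 1 + (z * 1 + 0))))) ≡ a₂ + (x + (y + z))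
  weight₂ = solve-∀

  weight₃ : ∀ a₁ a₂ a₃ x y z → a₁ * 0 + (a₂ * 0 + (a₃ * 1 + (x * 0 + (y * 1 + (z * 1 + 0))))) ≡ a₃ + (y + z)
  weight₃ = solve-∀

  χ-IsSol? : ∀ m n k i a₁ a₂ a₃ x y z →
    χ (does (IsSol? m n k i (a₁ ∷ a₂ ∷ a₃ ∷ x ∷ y ∷ z ∷ []))) ≡ solTerm m n k i a₁ a₂ a₃ x y z
  χ-IsSol? m n k i a₁ a₂ a₃ x y z =
    χ-equations (weight₁ a₁ a₂ a₃ x y z) (weight₂ a₁ a₂ a₃ x y z) (weight₃ a₁ a₂ a₃ x y z)
    where
    χ-equations : ∀ {w₁ w₂ w₃} → w₁ ≡ a₁ + (x + z) → w₂ ≡ a₂ + (x + (y + z)) → w₃ ≡ a₃ + (y + z) →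
      χ (((w₁ ≡ᵇ m) ∧ ((w₂ ≡ᵇ n) ∧ ((w₃ ≡ᵇ k) ∧ true))) ∧ (a₁ + (a₂ + (a₃ + (x + (y + (z + 0))))) ≡ᵇ i))
        ≡ solTerm m n k i a₁ a₂ a₃ x y z
    χ-equations refl refl refl =
      χ-∧⁴ (a₁ + (x + z) ≡ᵇ m) (a₂ + (x + (y + z)) ≡ᵇ n) (a₃ + (y + z) ≡ᵇ k) (a₁ + (a₂ + (a₃ + (x + (y + (z + 0))))) ≡ᵇ i)

  ∑³ : ℕ → (ℕ → ℕ → ℕ → ℕ) → ℕ
  ∑³ N f = ∑ N λ a → ∑ N λ b → ∑ N λ c → f a b c

  ∑³-cong : ∀ N {f g : ℕ → ℕ → ℕ → ℕ} → (∀ a b c → f a b c ≡ g a b c) → ∑³ N f ≡ ∑³ N g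
  ∑³-cong N {f} {g} h = ∑-cong N {g = λ a → ∑ N λ b → ∑ N λ c → g a b c} λ a _ →
    ∑-cong N {g = λ b → ∑ N λ c → g a b c} λ b _ → ∑-cong N {g = λ c → g a b c} λ c _ → h a b c

  ∑-∑³-comm : ∀ N (f : ℕ → ℕ → ℕ → ℕ → ℕ) →
    ∑ N (λ a → ∑³ N (λ x y z → f a x y z)) ≡ ∑³ N (λ x y z → ∑ N (λ a → f a x y z))
  ∑-∑³-comm N f =
    trans (∑-comm N N (λ a x → ∑ N λ y → ∑ N λ z → f a x y z))
    (∑-cong N {g = λ x → ∑ N λ y → ∑ N λ z → ∑ N λ a → f a x y z} λ x _ →
     trans (∑-comm N N (λ a y → ∑ N λ z → f a x y z))
     (∑-cong N {g = λ y → ∑ N λ z → ∑ N λ a → f a x y z} λ y _ → ∑-comm N N (λ a z → f a x y z)))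

  ∑³-comm : ∀ N (f : ℕ → ℕ → ℕ → ℕ → ℕ → ℕ → ℕ) →
    ∑³ N (λ a b c → ∑³ N (λ x y z → f a b c x y z)) ≡ ∑³ N (λ x y z → ∑³ N (λ a b c → f a b c x y z))
  ∑³-comm N f =
    trans (∑-cong N {g = λ a → ∑ N λ b → ∑³ N (λ x y z → ∑ N λ c → f a b c x y z)} λ a _ →
            ∑-cong N {g = λ b → ∑³ N (λ x y z → ∑ N λ c → f a b c x y z)} λ b _ →
              ∑-∑³-comm N (λ c x y z → f a b c x y z))
    (trans (∑-cong N {g = λ a → ∑³ N (λ x y z → ∑ N λ b → ∑ N λ c → f a b c x y z)} λ a _ →
            ∑-∑³-comm N (λ b x y z → ∑ N λ c → f a b c x y z))
    (∑-∑³-comm N (λ a x y z → ∑ N λ b → ∑ N λ c → f a b c x y z)))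

  kpfCoeff-∑⁶ : ∀ m n k i → kpfCoeff m n k i ≡
    ∑³ (suc (m + n + k)) (λ a₁ a₂ a₃ → ∑³ (suc (m + n + k)) (λ x y z → solTerm m n k i a₁ a₂ a₃ x y z))
  kpfCoeff-∑⁶ m n k i =
    trans (length-filter (IsSol? m n k i) (boxed B 6))
    (trans (count-boxed B 6 (λ a → does (IsSol? m n k i a)))
    (∑³-cong (suc B) λ a₁ a₂ a₃ → ∑³-cong (suc B) λ x y z → χ-IsSol? m n k i a₁ a₂ a₃ x y z))
    where B = m + n + k

  -- Summing out a₁, a₂, a₃: they are forced by the three coordinate equations.
  ∑³-solTerm : ∀ N m n k i x y z → m < N → n < N → k < N →
    ∑³ N (λ a₁ a₂ a₃ → solTerm m n k i a₁ a₂ a₃ x y z) ≡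
    χ (x + z ≤ᵇ m) * (χ (x + (y + z) ≤ᵇ n) * (χ (y + z ≤ᵇ k) *
      χ ((m ∸ (x + z)) + ((n ∸ (x + (y + z))) + ((k ∸ (y + z)) + (x + (y + (z + 0))))) ≡ᵇ i)))
  ∑³-solTerm N m n k i x y z m<N n<N k<N = begin
    ∑ N (λ a₁ → ∑ N λ a₂ → ∑ N λ a₃ → χ (a₁ + P ≡ᵇ m) * (χ (a₂ + Q ≡ᵇ n) * (χ (a₃ + R ≡ᵇ k) * size≡ a₁ a₂ a₃)))
      ≡⟨ ∑-cong N (λ a₁ _ → ∑-cong N (λ a₂ _ →
           trans (∑-*ˡ N (χ (a₁ + P ≡ᵇ m)) _)
           (cong (χ (a₁ + P ≡ᵇ m) *_) (trans (∑-*ˡ N (χ (a₂ + Q ≡ᵇ n)) _)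
           (cong (χ (a₂ + Q ≡ᵇ n) *_) (∑-select N R k (size≡ a₁ a₂) k<N)))))) ⟩
    ∑ N (λ a₁ → ∑ N λ a₂ → χ (a₁ + P ≡ᵇ m) * (χ (a₂ + Q ≡ᵇ n) * (χ (R ≤ᵇ k) * size≡ a₁ a₂ (k ∸ R))))
      ≡⟨ ∑-cong N (λ a₁ _ →
           trans (∑-*ˡ N (χ (a₁ + P ≡ᵇ m)) _)
           (cong (χ (a₁ + P ≡ᵇ m) *_) (∑-select N Q n (λ a₂ → χ (R ≤ᵇ k) * size≡ a₁ a₂ (k ∸ R)) n<N))) ⟩
    ∑ N (λ a₁ → χ (a₁ + P ≡ᵇ m) * (χ (Q ≤ᵇ n) * (χ (R ≤ᵇ k) * size≡ a₁ (n ∸ Q) (k ∸ R))))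
      ≡⟨ ∑-select N P m (λ a₁ → χ (Q ≤ᵇ n) * (χ (R ≤ᵇ k) * size≡ a₁ (n ∸ Q) (k ∸ R))) m<N ⟩
    χ (P ≤ᵇ m) * (χ (Q ≤ᵇ n) * (χ (R ≤ᵇ k) * size≡ (m ∸ P) (n ∸ Q) (k ∸ R))) ∎
    where
    open ≡-Reasoning
    P = x + z
    Q = x + (y + z)
    R = y + z
    size≡ : ℕ → ℕ → ℕ → ℕ
    size≡ a₁ a₂ a₃ = χ (a₁ + (a₂ + (a₃ + (x + (y + (z + 0))))) ≡ᵇ i)

  bounds : ℕ → ℕ → ℕ → ℕ → ℕ → ℕ → ℕ
  bounds m n k x y z = χ (x + z ≤ᵇ m) * (χ (x + (y + z) ≤ᵇ n) * χ (y + z ≤ᵇ k))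

  tripleTerm : ℕ → ℕ → ℕ → ℕ → ℕ → ℕ → ℕ → ℕ
  tripleTerm m n k i x y z = χ (y + (x + (z + z) + i) ≡ᵇ m + n + k) * bounds m n k x y z

  total-size : ∀ a₁ a₂ a₃ x y z →
    (a₁ + (x + z)) + (a₂ + (x + (y + z))) + (a₃ + (y + z)) ≡ a₁ + (a₂ + (a₃ + (x + (y + (z + 0))))) + (y + (x + (z + z)))
  total-size = solve-∀

  forced≡tripleTerm : ∀ m n k i x y z →
    χ (x + z ≤ᵇ m) * (χ (x + (y + z) ≤ᵇ n) * (χ (y + z ≤ᵇ k) *
      χ ((m ∸ (x + z)) + ((n ∸ (x + (y + z))) + ((k ∸ (y + z)) + (x + (y + (z + 0))))) ≡ᵇ i)))
    ≡ tripleTerm m n k i x y z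
  forced≡tripleTerm m n k i x y z with x + z ≤? m | x + (y + z) ≤? n | y + z ≤? k
  ... | no p | _ | _ rewrite χ-≰ᵇ (≰⇒> p) = sym (*-zeroʳ (χ (y + (x + (z + z) + i) ≡ᵇ m + n + k)))
  ... | yes p | no q | _ rewrite χ-≤ᵇ p | χ-≰ᵇ (≰⇒> q) = sym (*-zeroʳ (χ (y + (x + (z + z) + i) ≡ᵇ m + n + k)))
  ... | yes p | yes q | no r rewrite χ-≤ᵇ p | χ-≤ᵇ q | χ-≰ᵇ (≰⇒> r) = sym (*-zeroʳ (χ (y + (x + (z + z) + i) ≡ᵇ m + n + k)))
  ... | yes p | yes q | yes r rewrite χ-≤ᵇ p | χ-≤ᵇ q | χ-≤ᵇ r =
    trans (unitˡ (χ (sz ≡ᵇ i))) (trans (χ-≡ᵇ-⇔ to from) (sym (unitʳ (χ (y + (x + (z + z) + i) ≡ᵇ m + n + k)))))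
    where
    unitˡ : ∀ c → 1 * (1 * (1 * c)) ≡ c
    unitˡ = solve-∀
    unitʳ : ∀ c → c * (1 * (1 * 1)) ≡ c
    unitʳ = solve-∀
    a₁ = m ∸ (x + z)
    a₂ = n ∸ (x + (y + z))
    a₃ = k ∸ (y + z)
    sz = a₁ + (a₂ + (a₃ + (x + (y + (z + 0)))))
    d = y + (x + (z + z))
    m+n+k≡sz+d : m + n + k ≡ sz + d
    m+n+k≡sz+d = begin
      m + n + k
        ≡⟨ sym (cong₂ _+_ (cong₂ _+_ (m∸n+n≡m p) (m∸n+n≡m q)) (m∸n+n≡m r)) ⟩
      (a₁ + (x + z)) + (a₂ + (x + (y + z))) + (a₃ + (y + z))
        ≡⟨ total-size a₁ a₂ a₃ x y z ⟩
      sz + d ∎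
      where open ≡-Reasoning
    reorder : y + (x + (z + z) + i) ≡ i + d
    reorder = lemma x y z i
      where
      lemma : ∀ x y z i → y + (x + (z + z) + i) ≡ i + (y + (x + (z + z)))
      lemma = solve-∀
    to : sz ≡ i → y + (x + (z + z) + i) ≡ m + n + k
    to e = trans reorder (sym (trans m+n+k≡sz+d (cong (_+ d) e)))
    from : y + (x + (z + z) + i) ≡ m + n + k → sz ≡ i
    from e = +-cancelʳ-≡ d sz i (trans (sym m+n+k≡sz+d) (trans (sym e) reorder))

  kpfCoeff-∑³ : ∀ m n k i → kpfCoeff m n k i ≡ ∑³ (suc (m + n + k)) (tripleTerm m n k i)
  kpfCoeff-∑³ m n k i = begin
    kpfCoeff m n k i
      ≡⟨ kpfCoeff-∑⁶ m n k i ⟩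
    ∑³ N (λ a₁ a₂ a₃ → ∑³ N (λ x y z → solTerm m n k i a₁ a₂ a₃ x y z))
      ≡⟨ ∑³-comm N (solTerm m n k i) ⟩
    ∑³ N (λ x y z → ∑³ N (λ a₁ a₂ a₃ → solTerm m n k i a₁ a₂ a₃ x y z))
      ≡⟨ ∑³-cong N (λ x y z → trans (∑³-solTerm N m n k i x y z m<N n<N k<N) (forced≡tripleTerm m n k i x y z)) ⟩
    ∑³ N (tripleTerm m n k i) ∎
    where
    open ≡-Reasoning
    N = suc (m + n + k)
    m<N : m < N
    m<N = s≤s (≤-trans (m≤m+n m n) (m≤m+n (m + n) k))
    n<N : n < N
    n<N = s≤s (≤-trans (m≤n+m n m) (m≤m+n (m + n) k))
    k<N : k < N
    k<N = s≤s (m≤n+m k (m + n))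


module Slices where

  open import Data.Nat
  open import Data.Nat.Properties
  open import Data.Bool using (Bool; T; _∧_)
  open import Data.Bool.Properties using (T-∧)
  open import Data.Product using (_×_; _,_; proj₁)
  open import Function.Bundles using (module Equivalence)
  open import Relation.Nullary using (¬_; yes; no)
  open import Relation.Binary.PropositionalEquality
  open import Data.Nat.Tactic.RingSolver
  open import Defs
  open FiniteSums
  open Counting

  -- For fixed t = m + n + k − i and z, the solutions are parametrised by x ∈ [xLow, xHigh]
  -- (with y = t − x − 2z), provided z is admissible; slice counts them.
  admissible : ℕ → ℕ → ℕ → ℕ → Bool
  admissible m n t z = (z + z ≤ᵇ t) ∧ ((z ≤ᵇ m) ∧ (t ≤ᵇ n + z))

  xLow : ℕ → ℕ → ℕ → ℕ
  xLow k t z = (t ∸ z) ∸ k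

  xHigh : ℕ → ℕ → ℕ → ℕ
  xHigh m t z = (m ∸ z) ⊓ (t ∸ (z + z))

  slice : ℕ → ℕ → ℕ → ℕ → ℕ → ℕ
  slice m n k t z = χ (admissible m n t z) * (suc (xHigh m t z) ∸ xLow k t z)

  T-∧-intro : ∀ {a b} → T a → T b → T (a ∧ b)
  T-∧-intro p q = Equivalence.from T-∧ (p , q)

  T-∧-proj : ∀ {a b} → T (a ∧ b) → T a × T b
  T-∧-proj = Equivalence.to T-∧

  admissible-intro : ∀ {m n t z} → z + z ≤ t → z ≤ m → t ≤ n + z → T (admissible m n t z)
  admissible-intro zz≤t z≤m t≤n+z = T-∧-intro (≤⇒≤ᵇ zz≤t) (T-∧-intro (≤⇒≤ᵇ z≤m) (≤⇒≤ᵇ t≤n+z))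

  admissible-elim : ∀ {m n t z} → T (admissible m n t z) → z + z ≤ t × z ≤ m × t ≤ n + z
  admissible-elim {m} {n} {t} {z} adm with T-∧-proj adm
  ... | zz≤t , rest with T-∧-proj {z ≤ᵇ m} rest
  ...   | z≤m , t≤n+z = ≤ᵇ⇒≤ _ _ zz≤t , ≤ᵇ⇒≤ _ _ z≤m , ≤ᵇ⇒≤ _ _ t≤n+z

  regroup₁ : ∀ x z d → x + (z + z) + d ≡ (x + (d + z)) + z
  regroup₁ = solve-∀

  regroup₂ : ∀ x z d → (x + (d + z)) + z ≡ ((d + z) + x) + z
  regroup₂ = solve-∀

  bounds-interval : ∀ m n k t z x d → x + (z + z) + d ≡ t →
    (x + z ≤ m × x + (d + z) ≤ n × d + z ≤ k) →
    T (admissible m n t z) × xLow k t z ≤ x × x ≤ xHigh m t z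
  bounds-interval m n k t z x d x+2z+d≡t (x+z≤m , x+d+z≤n , d+z≤k) =
    admissible-intro zz≤t z≤m t≤n+z , xLow≤x , ⊓-glb (m+n≤o⇒m≤o∸n x x+z≤m) x≤t∸zz
    where
    zz≤t : z + z ≤ t
    zz≤t = subst (z + z ≤_) x+2z+d≡t (≤-trans (m≤n+m (z + z) x) (m≤m+n (x + (z + z)) d))
    x≤t∸zz : x ≤ t ∸ (z + z)
    x≤t∸zz = m+n≤o⇒m≤o∸n x (subst (x + (z + z) ≤_) x+2z+d≡t (m≤m+n (x + (z + z)) d))
    z≤m : z ≤ m
    z≤m = m+n≤o⇒n≤o x x+z≤m
    t≡ : t ≡ (x + (d + z)) + z
    t≡ = trans (sym x+2z+d≡t) (regroup₁ x z d)
    t≤n+z : t ≤ n + z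
    t≤n+z = subst (_≤ n + z) (sym t≡) (+-monoˡ-≤ z x+d+z≤n)
    t≤z+[k+x] : t ≤ z + (k + x)
    t≤z+[k+x] = subst (_≤ z + (k + x)) (sym (trans t≡ (regroup₂ x z d)))
                  (subst (((d + z) + x) + z ≤_) (+-comm (k + x) z) (+-monoˡ-≤ z (+-monoˡ-≤ x d+z≤k)))
    xLow≤x : xLow k t z ≤ x
    xLow≤x = m≤n+o⇒m∸n≤o (t ∸ z) k (m≤n+o⇒m∸n≤o t z t≤z+[k+x])

  interval-bounds : ∀ m n k t z x d → x + (z + z) + d ≡ t →
    T (admissible m n t z) → xLow k t z ≤ x → x ≤ xHigh m t z →
    x + z ≤ m × x + (d + z) ≤ n × d + z ≤ k
  interval-bounds m n k t z x d x+2z+d≡t adm xLow≤x x≤xHigh with admissible-elim adm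
  ... | zz≤t , z≤m , t≤n+z = x+z≤m , x+d+z≤n , d+z≤k
    where
    t≡ : t ≡ (x + (d + z)) + z
    t≡ = trans (sym x+2z+d≡t) (regroup₁ x z d)
    x+z≤m : x + z ≤ m
    x+z≤m = m≤o∸n⇒m+n≤o x z≤m (≤-trans x≤xHigh (m⊓n≤m (m ∸ z) (t ∸ (z + z))))
    x+d+z≤n : x + (d + z) ≤ n
    x+d+z≤n = +-cancelʳ-≤ z (x + (d + z)) n (subst (_≤ n + z) t≡ t≤n+z)
    t≤k+x+z : t ≤ (k + x) + z
    t≤k+x+z = begin
      t             ≡⟨ sym (m∸n+n≡m (≤-trans (m≤m+n z z) zz≤t)) ⟩
      (t ∸ z) + z   ≤⟨ +-monoˡ-≤ z (≤-trans (m≤n+m∸n (t ∸ z) k) (+-monoʳ-≤ k xLow≤x)) ⟩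
      (k + x) + z   ∎
      where open ≤-Reasoning
    d+z≤k : d + z ≤ k
    d+z≤k = +-cancelʳ-≤ x (d + z) k (+-cancelʳ-≤ z ((d + z) + x) (k + x)
              (subst (_≤ (k + x) + z) (trans t≡ (regroup₂ x z d)) t≤k+x+z))

  χ-∧³ : ∀ a b c → χ (a ∧ (b ∧ c)) ≡ χ a * (χ b * χ c)
  χ-∧³ a b c = trans (χ-∧ a (b ∧ c)) (cong (χ a *_) (χ-∧ b c))

  bounds≡slice-indicator : ∀ m n k t z x d → x + (z + z) + d ≡ t →
    bounds m n k x d z ≡ χ (admissible m n t z) * (χ (xLow k t z ≤ᵇ x) * χ (x ≤ᵇ xHigh m t z))
  bounds≡slice-indicator m n k t z x d x+2z+d≡t = begin
    χ (x + z ≤ᵇ m) * (χ (x + (d + z) ≤ᵇ n) * χ (d + z ≤ᵇ k))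
      ≡⟨ sym (χ-∧³ (x + z ≤ᵇ m) (x + (d + z) ≤ᵇ n) (d + z ≤ᵇ k)) ⟩
    χ ((x + z ≤ᵇ m) ∧ ((x + (d + z) ≤ᵇ n) ∧ (d + z ≤ᵇ k)))
      ≡⟨ χ-cong-⇔ to from ⟩
    χ (admissible m n t z ∧ ((xLow k t z ≤ᵇ x) ∧ (x ≤ᵇ xHigh m t z)))
      ≡⟨ χ-∧³ (admissible m n t z) (xLow k t z ≤ᵇ x) (x ≤ᵇ xHigh m t z) ⟩
    χ (admissible m n t z) * (χ (xLow k t z ≤ᵇ x) * χ (x ≤ᵇ xHigh m t z)) ∎
    where
    open ≡-Reasoning
    to : T ((x + z ≤ᵇ m) ∧ ((x + (d + z) ≤ᵇ n) ∧ (d + z ≤ᵇ k))) →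
         T (admissible m n t z ∧ ((xLow k t z ≤ᵇ x) ∧ (x ≤ᵇ xHigh m t z)))
    to h with T-∧-proj h
    ... | p , qr with T-∧-proj {x + (d + z) ≤ᵇ n} qr
    ...   | q , r with bounds-interval m n k t z x d x+2z+d≡t (≤ᵇ⇒≤ _ _ p , ≤ᵇ⇒≤ _ _ q , ≤ᵇ⇒≤ _ _ r)
    ...     | adm , lo≤x , x≤hi = T-∧-intro adm (T-∧-intro (≤⇒≤ᵇ lo≤x) (≤⇒≤ᵇ x≤hi))
    from : T (admissible m n t z ∧ ((xLow k t z ≤ᵇ x) ∧ (x ≤ᵇ xHigh m t z))) →
           T ((x + z ≤ᵇ m) ∧ ((x + (d + z) ≤ᵇ n) ∧ (d + z ≤ᵇ k)))
    from h with T-∧-proj {admissible m n t z} h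
    ... | adm , lohi with T-∧-proj {xLow k t z ≤ᵇ x} lohi
    ...   | lo≤x , x≤hi with interval-bounds m n k t z x d x+2z+d≡t adm (≤ᵇ⇒≤ _ _ lo≤x) (≤ᵇ⇒≤ _ _ x≤hi)
    ...     | p , q , r = T-∧-intro (≤⇒≤ᵇ p) (T-∧-intro (≤⇒≤ᵇ q) (≤⇒≤ᵇ r))

  -- The term of the (z, x) double sum left after summing out y = m + n + k − i − x − 2z.
  pairTerm : ℕ → ℕ → ℕ → ℕ → ℕ → ℕ → ℕ
  pairTerm m n k i z x =
    χ (x + (z + z) + i ≤ᵇ m + n + k) * bounds m n k x (m + n + k ∸ (x + (z + z) + i)) z

  kpfCoeff-∑² : ∀ m n k i →
    kpfCoeff m n k i ≡ ∑ (suc (m + n + k)) λ z → ∑ (suc (m + n + k)) λ x → pairTerm m n k i z x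
  kpfCoeff-∑² m n k i = begin
    kpfCoeff m n k i
      ≡⟨ kpfCoeff-∑³ m n k i ⟩
    ∑³ N (tripleTerm m n k i)
      ≡⟨ ∑-cong N (λ x _ → ∑-comm N N (λ y z → tripleTerm m n k i x y z)) ⟩
    ∑ N (λ x → ∑ N λ z → ∑ N λ y → tripleTerm m n k i x y z)
      ≡⟨ ∑-comm N N (λ x z → ∑ N λ y → tripleTerm m n k i x y z) ⟩
    ∑ N (λ z → ∑ N λ x → ∑ N λ y → tripleTerm m n k i x y z)
      ≡⟨ ∑-cong N (λ z _ → ∑-cong N (λ x _ →
           ∑-select N (x + (z + z) + i) (m + n + k) (λ y → bounds m n k x y z) (n<1+n _))) ⟩
    ∑ N (λ z → ∑ N λ x → pairTerm m n k i z x) ∎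
    where
    open ≡-Reasoning
    N = suc (m + n + k)

  kpfCoeff-above : ∀ m n k i → m + n + k < i → kpfCoeff m n k i ≡ 0
  kpfCoeff-above m n k i m+n+k<i = trans (kpfCoeff-∑² m n k i)
    (∑-zero (suc (m + n + k)) λ z _ → ∑-zero (suc (m + n + k)) λ x _ →
      cong (_* bounds m n k x (m + n + k ∸ (x + (z + z) + i)) z)
           (χ-≰ᵇ (<-≤-trans m+n+k<i (m≤n+m i (x + (z + z))))))

  pairTerm≡slice-indicator : ∀ m n k t i z x → m + n + k ≡ t + i →
    pairTerm m n k i z x ≡ χ (admissible m n t z) * (χ (xLow k t z ≤ᵇ x) * χ (x ≤ᵇ xHigh m t z))
  pairTerm≡slice-indicator m n k t i z x m+n+k≡t+i with x + (z + z) ≤? t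
  ... | yes x+2z≤t = begin
    χ (x + (z + z) + i ≤ᵇ m + n + k) * bounds m n k x (m + n + k ∸ (x + (z + z) + i)) z
      ≡⟨ cong₂ _*_ (χ-≤ᵇ (subst (x + (z + z) + i ≤_) (sym m+n+k≡t+i) (+-monoˡ-≤ i x+2z≤t)))
                   (cong (λ y → bounds m n k x y z) y≡d) ⟩
    1 * bounds m n k x d z
      ≡⟨ *-identityˡ _ ⟩
    bounds m n k x d z
      ≡⟨ bounds≡slice-indicator m n k t z x d (m+[n∸m]≡n x+2z≤t) ⟩
    χ (admissible m n t z) * (χ (xLow k t z ≤ᵇ x) * χ (x ≤ᵇ xHigh m t z)) ∎
    where
    open ≡-Reasoning
    d = t ∸ (x + (z + z))
    y≡d : m + n + k ∸ (x + (z + z) + i) ≡ d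
    y≡d = trans (cong₂ _∸_ (trans m+n+k≡t+i (+-comm t i)) (+-comm (x + (z + z)) i))
                ([m+n]∸[m+o]≡n∸o i t (x + (z + z)))
  ... | no x+2z≰t = trans (cong (_* bounds m n k x (m + n + k ∸ (x + (z + z) + i)) z) (χ-≰ᵇ m+n+k<)) (sym outside)
    where
    m+n+k< : m + n + k < x + (z + z) + i
    m+n+k< = subst (_< x + (z + z) + i) (sym m+n+k≡t+i) (+-monoˡ-< i (≰⇒> x+2z≰t))
    outside : χ (admissible m n t z) * (χ (xLow k t z ≤ᵇ x) * χ (x ≤ᵇ xHigh m t z)) ≡ 0
    outside with z + z ≤? t
    ... | yes zz≤t = begin
      χ (admissible m n t z) * (χ (xLow k t z ≤ᵇ x) * χ (x ≤ᵇ xHigh m t z))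
        ≡⟨ cong (λ u → χ (admissible m n t z) * (χ (xLow k t z ≤ᵇ x) * u)) (χ-≰ᵇ (≰⇒> x≰xHigh)) ⟩
      χ (admissible m n t z) * (χ (xLow k t z ≤ᵇ x) * 0)
        ≡⟨ cong (χ (admissible m n t z) *_) (*-zeroʳ (χ (xLow k t z ≤ᵇ x))) ⟩
      χ (admissible m n t z) * 0
        ≡⟨ *-zeroʳ (χ (admissible m n t z)) ⟩
      0 ∎
      where
      open ≡-Reasoning
      x≰xHigh : ¬ (x ≤ xHigh m t z)
      x≰xHigh h = x+2z≰t (m≤o∸n⇒m+n≤o x zz≤t (≤-trans h (m⊓n≤n (m ∸ z) (t ∸ (z + z)))))
    ... | no zz≰t = cong (_* (χ (xLow k t z ≤ᵇ x) * χ (x ≤ᵇ xHigh m t z)))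
                         (χ-false (λ adm → zz≰t (proj₁ (admissible-elim {m} {n} {t} {z} adm))))

  kpfCoeff-slices : ∀ m n k i → i ≤ m + n + k →
    kpfCoeff m n k i ≡ ∑ (suc (m + n + k)) (slice m n k (m + n + k ∸ i))
  kpfCoeff-slices m n k i i≤m+n+k = trans (kpfCoeff-∑² m n k i)
    (∑-cong N {g = slice m n k t} λ z _ →
      trans (∑-cong N (λ x _ → pairTerm≡slice-indicator m n k t i z x m+n+k≡t+i))
      (trans (∑-*ˡ N (χ (admissible m n t z)) (λ x → χ (xLow k t z ≤ᵇ x) * χ (x ≤ᵇ xHigh m t z)))
        (cong (χ (admissible m n t z) *_) (∑-interval N (xLow k t z) (xHigh m t z) (xHigh<N z)))))
    where
    N = suc (m + n + k)
    t = m + n + k ∸ i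
    m+n+k≡t+i : m + n + k ≡ t + i
    m+n+k≡t+i = sym (m∸n+n≡m i≤m+n+k)
    xHigh<N : ∀ z → xHigh m t z < N
    xHigh<N z = s≤s (≤-trans (m⊓n≤m (m ∸ z) (t ∸ (z + z)))
                    (≤-trans (m∸n≤m m z) (≤-trans (m≤m+n m n) (m≤m+n (m + n) k))))


module Symmetry where

  open import Data.Nat
  open import Relation.Binary.PropositionalEquality
  open import Data.Nat.Tactic.RingSolver
  open import Defs
  open FiniteSums
  open Counting

  +-reverse₃ : ∀ a b c → a + b + c ≡ c + b + a
  +-reverse₃ = solve-∀

  -- Exchanging α₁ and α₃ swaps m with k and the roots α₁+α₂ with α₂+α₃.
  tripleTerm-swap : ∀ m n k i x y z → tripleTerm k n m i y x z ≡ tripleTerm m n k i x y z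
  tripleTerm-swap m n k i x y z = begin
    χ (x + (y + (z + z) + i) ≡ᵇ k + n + m) * (χ (y + z ≤ᵇ k) * (χ (y + (x + z) ≤ᵇ n) * χ (x + z ≤ᵇ m)))
      ≡⟨ cong₂ (λ a b → χ (a ≡ᵇ b) * (χ (y + z ≤ᵇ k) * (χ (y + (x + z) ≤ᵇ n) * χ (x + z ≤ᵇ m))))
               (swap-size x y z i) (+-reverse₃ k n m) ⟩
    χ (y + (x + (z + z) + i) ≡ᵇ m + n + k) * (χ (y + z ≤ᵇ k) * (χ (y + (x + z) ≤ᵇ n) * χ (x + z ≤ᵇ m)))
      ≡⟨ cong (λ a → χ (y + (x + (z + z) + i) ≡ᵇ m + n + k) * (χ (y + z ≤ᵇ k) * (χ (a ≤ᵇ n) * χ (x + z ≤ᵇ m))))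
              (swap-middle x y z) ⟩
    χ (y + (x + (z + z) + i) ≡ᵇ m + n + k) * (χ (y + z ≤ᵇ k) * (χ (x + (y + z) ≤ᵇ n) * χ (x + z ≤ᵇ m)))
      ≡⟨ reverse-factors (χ (y + (x + (z + z) + i) ≡ᵇ m + n + k)) (χ (y + z ≤ᵇ k)) (χ (x + (y + z) ≤ᵇ n)) (χ (x + z ≤ᵇ m)) ⟩
    χ (y + (x + (z + z) + i) ≡ᵇ m + n + k) * (χ (x + z ≤ᵇ m) * (χ (x + (y + z) ≤ᵇ n) * χ (y + z ≤ᵇ k))) ∎
    where
    open ≡-Reasoning
    swap-size : ∀ x y z i → x + (y + (z + z) + i) ≡ y + (x + (z + z) + i)
    swap-size = solve-∀
    swap-middle : ∀ x y z → y + (x + z) ≡ x + (y + z)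
    swap-middle = solve-∀
    reverse-factors : ∀ a b c d → a * (b * (c * d)) ≡ a * (d * (c * b))
    reverse-factors = solve-∀

  kpfCoeff-swap : ∀ m n k i → kpfCoeff k n m i ≡ kpfCoeff m n k i
  kpfCoeff-swap m n k i = begin
    kpfCoeff k n m i
      ≡⟨ kpfCoeff-∑³ k n m i ⟩
    ∑³ (suc (k + n + m)) (tripleTerm k n m i)
      ≡⟨ cong (λ N → ∑³ (suc N) (tripleTerm k n m i)) (+-reverse₃ k n m) ⟩
    ∑³ N (tripleTerm k n m i)
      ≡⟨ ∑-comm N N (λ a b → ∑ N (λ z → tripleTerm k n m i a b z)) ⟩
    ∑³ N (λ x y z → tripleTerm k n m i y x z)
      ≡⟨ ∑³-cong N (tripleTerm-swap m n k i) ⟩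
    ∑³ N (tripleTerm m n k i)
      ≡⟨ sym (kpfCoeff-∑³ m n k i) ⟩
    kpfCoeff m n k i ∎
    where
    open ≡-Reasoning
    N = suc (m + n + k)


module ArithmeticSums where

  open import Data.Nat as ℕ using (ℕ; zero; suc; z≤n; s≤s; _≤_; _<_)
  import Data.Nat.Properties as ℕP
  open import Data.Integer using (ℤ; +_; _+_; _-_; _*_)
  open import Data.Integer.Properties using (pos-+; [+m]-[+n]≡m⊖n; ⊖-≥)
  import Data.Integer.Properties as ℤP
  open import Relation.Binary.PropositionalEquality
  open import Data.Integer.Tactic.RingSolver
  open FiniteSums

  cong₃ : ∀ {A B C D : Set} (f : A → B → C → D) {a a′ b b′ c c′} → a ≡ a′ → b ≡ b′ → c ≡ c′ → f a b c ≡ f a′ b′ c′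
  cong₃ f refl refl refl = refl

  pos-∸ : ∀ {m n} → n ≤ m → + (m ℕ.∸ n) ≡ + m - + n
  pos-∸ {m} {n} n≤m = sym (trans ([+m]-[+n]≡m⊖n m n) (⊖-≥ n≤m))

  ∑ℤ : ℕ → (ℕ → ℤ) → ℤ
  ∑ℤ zero f = + 0
  ∑ℤ (suc N) f = f 0 + ∑ℤ N (λ j → f (suc j))

  pos-∑ : ∀ N (f : ℕ → ℕ) → + ∑ N f ≡ ∑ℤ N (λ j → + f j)
  pos-∑ zero f = refl
  pos-∑ (suc N) f = trans (pos-+ (f 0) (∑ N (λ j → f (suc j)))) (cong (λ u → + f 0 + u) (pos-∑ N (λ j → f (suc j))))

  ∑ℤ-cong : ∀ N {f g : ℕ → ℤ} → (∀ j → j < N → f j ≡ g j) → ∑ℤ N f ≡ ∑ℤ N g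
  ∑ℤ-cong zero h = refl
  ∑ℤ-cong (suc N) h = cong₂ _+_ (h 0 (s≤s z≤n)) (∑ℤ-cong N (λ j j<N → h (suc j) (s≤s j<N)))

  -- Twice the sum of A + B z over the l consecutive integers z = c, …, c + l − 1.
  twiceArithSum : ℤ → ℤ → ℤ → ℤ → ℤ
  twiceArithSum l A B c = + 2 * l * A + B * (l * (+ 2 * c + l - + 1))

  ∑ℤ-affine : ∀ l A B c → + 2 * ∑ℤ l (λ j → A + B * (c + + j)) ≡ twiceArithSum (+ l) A B c
  ∑ℤ-affine zero A B c = empty A B c
    where
    empty : ∀ A B c → + 2 * + 0 ≡ + 2 * + 0 * A + B * (+ 0 * (+ 2 * c + + 0 - + 1))
    empty = solve-∀
  ∑ℤ-affine (suc l) A B c = begin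
    + 2 * (A + B * (c + + 0) + ∑ℤ l (λ j → A + B * (c + + suc j)))
      ≡⟨ cong (λ u → + 2 * (A + B * (c + + 0) + u)) (∑ℤ-cong l (λ j _ → cong (λ v → A + B * v) (sym (ℤP.+-assoc c (+ 1) (+ j))))) ⟩
    + 2 * (A + B * (c + + 0) + ∑ℤ l (λ j → A + B * ((c + + 1) + + j)))
      ≡⟨ peel A B c (∑ℤ l (λ j → A + B * ((c + + 1) + + j))) ⟩
    + 2 * (A + B * c) + + 2 * ∑ℤ l (λ j → A + B * ((c + + 1) + + j))
      ≡⟨ cong (λ u → + 2 * (A + B * c) + u) (∑ℤ-affine l A B (c + + 1)) ⟩
    + 2 * (A + B * c) + twiceArithSum (+ l) A B (c + + 1)
      ≡⟨ step A B c (+ l) ⟩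
    twiceArithSum (+ 1 + + l) A B c ∎
    where
    open ≡-Reasoning
    peel : ∀ A B c s → + 2 * (A + B * (c + + 0) + s) ≡ + 2 * (A + B * c) + + 2 * s
    peel = solve-∀
    step : ∀ A B c L → + 2 * (A + B * c) + (+ 2 * L * A + B * (L * (+ 2 * (c + + 1) + L - + 1))) ≡
      + 2 * (+ 1 + L) * A + B * ((+ 1 + L) * (+ 2 * c + (+ 1 + L) - + 1))
    step = solve-∀

  ∑-affine : ∀ a l A B (f : ℕ → ℕ) → (∀ j → j < l → + f (a ℕ.+ j) ≡ A + B * (+ a + + j)) →
    + 2 * + ∑ l (λ j → f (a ℕ.+ j)) ≡ twiceArithSum (+ l) A B (+ a)
  ∑-affine a l A B f affine =
    trans (cong (+ 2 *_) (trans (pos-∑ l (λ j → f (a ℕ.+ j))) (∑ℤ-cong l affine))) (∑ℤ-affine l A B (+ a))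

  ∑-piecewise-affine : ∀ a c₁ c₂ e (f : ℕ → ℕ) A₁ B₁ A₂ B₂ A₃ B₃ → a ≤ c₁ → c₁ ≤ c₂ → c₂ ≤ e →
    (∀ z → a ≤ z → z < c₁ → + f z ≡ A₁ + B₁ * + z) →
    (∀ z → c₁ ≤ z → z < c₂ → + f z ≡ A₂ + B₂ * + z) →
    (∀ z → c₂ ≤ z → z < e → + f z ≡ A₃ + B₃ * + z) →
    + 2 * + ∑ (e ℕ.∸ a) (λ j → f (a ℕ.+ j)) ≡
      twiceArithSum (+ c₁ - + a) A₁ B₁ (+ a)
      + (twiceArithSum (+ c₂ - + c₁) A₂ B₂ (+ c₁) + twiceArithSum (+ e - + c₂) A₃ B₃ (+ c₂))
  ∑-piecewise-affine a c₁ c₂ e f A₁ B₁ A₂ B₂ A₃ B₃ a≤c₁ c₁≤c₂ c₂≤e piece₁ piece₂ piece₃ = begin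
    + 2 * + ∑ (e ℕ.∸ a) (λ j → f (a ℕ.+ j))
      ≡⟨ cong (λ u → + 2 * + u) (trans (∑-split-at a c₁ e f a≤c₁ (ℕP.≤-trans c₁≤c₂ c₂≤e))
                                       (cong (∑ (c₁ ℕ.∸ a) (λ j → f (a ℕ.+ j)) ℕ.+_) (∑-split-at c₁ c₂ e f c₁≤c₂ c₂≤e))) ⟩
    + 2 * + (∑ l₁ (λ j → f (a ℕ.+ j)) ℕ.+ (∑ l₂ (λ j → f (c₁ ℕ.+ j)) ℕ.+ ∑ l₃ (λ j → f (c₂ ℕ.+ j))))
      ≡⟨ twice-sum₃ (∑ l₁ (λ j → f (a ℕ.+ j))) (∑ l₂ (λ j → f (c₁ ℕ.+ j))) (∑ l₃ (λ j → f (c₂ ℕ.+ j))) ⟩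
    + 2 * + ∑ l₁ (λ j → f (a ℕ.+ j)) + (+ 2 * + ∑ l₂ (λ j → f (c₁ ℕ.+ j)) + + 2 * + ∑ l₃ (λ j → f (c₂ ℕ.+ j)))
      ≡⟨ cong₂ _+_ (∑-affine a l₁ A₁ B₁ f (affine-on {A = A₁} {B₁} a≤c₁ piece₁))
           (cong₂ _+_ (∑-affine c₁ l₂ A₂ B₂ f (affine-on {A = A₂} {B₂} c₁≤c₂ piece₂)) (∑-affine c₂ l₃ A₃ B₃ f (affine-on {A = A₃} {B₃} c₂≤e piece₃))) ⟩
    twiceArithSum (+ l₁) A₁ B₁ (+ a) + (twiceArithSum (+ l₂) A₂ B₂ (+ c₁) + twiceArithSum (+ l₃) A₃ B₃ (+ c₂))
      ≡⟨ cong₃ (λ u v w → twiceArithSum u A₁ B₁ (+ a) + (twiceArithSum v A₂ B₂ (+ c₁) + twiceArithSum w A₃ B₃ (+ c₂)))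
               (pos-∸ a≤c₁) (pos-∸ c₁≤c₂) (pos-∸ c₂≤e) ⟩
    twiceArithSum (+ c₁ - + a) A₁ B₁ (+ a) + (twiceArithSum (+ c₂ - + c₁) A₂ B₂ (+ c₁) + twiceArithSum (+ e - + c₂) A₃ B₃ (+ c₂)) ∎
    where
    open ≡-Reasoning
    l₁ = c₁ ℕ.∸ a
    l₂ = c₂ ℕ.∸ c₁
    l₃ = e ℕ.∸ c₂
    affine-on : ∀ {p q} {A B} → p ≤ q → (∀ z → p ≤ z → z < q → + f z ≡ A + B * + z) →
      ∀ j → j < q ℕ.∸ p → + f (p ℕ.+ j) ≡ A + B * (+ p + + j)
    affine-on {p} {q} {A} {B} p≤q piece j j<q∸p =
      trans (piece (p ℕ.+ j) (ℕP.m≤m+n p j) (subst (p ℕ.+ j <_) (ℕP.m+[n∸m]≡n p≤q) (ℕP.+-monoʳ-< p j<q∸p)))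
            (cong (λ u → A + B * u) (pos-+ p j))
    twice-sum₃ : ∀ x y z → + 2 * + (x ℕ.+ (y ℕ.+ z)) ≡ + 2 * + x + (+ 2 * + y + + 2 * + z)
    twice-sum₃ x y z = trans (cong (+ 2 *_) (trans (pos-+ x (y ℕ.+ z)) (cong (λ u → + x + u) (pos-+ y z)))) (distrib (+ x) (+ y) (+ z))
      where
      distrib : ∀ x y z → + 2 * (x + (y + z)) ≡ + 2 * x + (+ 2 * y + + 2 * z)
      distrib = solve-∀

module SliceRegions where

  open import Data.Nat as ℕ using (ℕ; suc; z≤n; s≤s; _≤_; _<_)
  open import Data.Nat.Properties as ℕP using (≤-trans; m≤n+m; +-comm; +-assoc)
  open import Data.Integer using (+_; _+_; _-_; _*_; -_)
  open import Data.Bool using (T)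
  open import Data.Product using (_×_; _,_; proj₁; proj₂)
  open import Relation.Nullary using (¬_; yes; no)
  open import Relation.Binary.PropositionalEquality
  open import Data.Integer.Tactic.RingSolver
  open FiniteSums
  open Slices
  open ArithmeticSums

  slice-value : ∀ m n k t z → T (admissible m n t z) → xLow k t z ≤ suc (xHigh m t z) →
    + slice m n k t z ≡ + 1 + + xHigh m t z - + xLow k t z
  slice-value m n k t z adm xLow≤1+xHigh = begin
    + (χ (admissible m n t z) ℕ.* (suc (xHigh m t z) ℕ.∸ xLow k t z))
      ≡⟨ cong (λ u → + (u ℕ.* (suc (xHigh m t z) ℕ.∸ xLow k t z))) (χ-true adm) ⟩
    + (1 ℕ.* (suc (xHigh m t z) ℕ.∸ xLow k t z))
      ≡⟨ cong +_ (ℕP.*-identityˡ _) ⟩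
    + (suc (xHigh m t z) ℕ.∸ xLow k t z)
      ≡⟨ pos-∸ xLow≤1+xHigh ⟩
    + 1 + + xHigh m t z - + xLow k t z ∎
    where open ≡-Reasoning

  slice-inadmissible : ∀ m n k t z → ¬ T (admissible m n t z) → slice m n k t z ≡ 0
  slice-inadmissible m n k t z ¬adm = cong (ℕ._* (suc (xHigh m t z) ℕ.∸ xLow k t z)) (χ-false ¬adm)

  slice-empty : ∀ m n k t z → xHigh m t z < xLow k t z → slice m n k t z ≡ 0
  slice-empty m n k t z xHigh<xLow =
    trans (cong (χ (admissible m n t z) ℕ.*_) (ℕP.m≤n⇒m∸n≡0 xHigh<xLow)) (ℕP.*-zeroʳ (χ (admissible m n t z)))

  slice-beyond-k : ∀ m n k t z → z ℕ.+ z ≤ t → k < z → slice m n k t z ≡ 0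
  slice-beyond-k m n k t z zz≤t k<z = slice-empty m n k t z
    (ℕP.<-≤-trans (s≤s (ℕP.m⊓n≤n (m ℕ.∸ z) (t ℕ.∸ (z ℕ.+ z)))) t∸2z<xLow)
    where
    d = t ℕ.∸ (z ℕ.+ z)
    t≡2z+d : t ≡ (z ℕ.+ z) ℕ.+ d
    t≡2z+d = sym (ℕP.m+[n∸m]≡n zz≤t)
    t∸2z<xLow : suc (t ℕ.∸ (z ℕ.+ z)) ≤ (t ℕ.∸ z) ℕ.∸ k
    t∸2z<xLow rewrite t≡2z+d | ℕP.m+n∸m≡n (z ℕ.+ z) d | ℕP.+-assoc z z d | ℕP.m+n∸m≡n z (z ℕ.+ d) =
      ℕP.m+n≤o⇒m≤o∸n (suc d) (subst (_≤ z ℕ.+ d) (trans (sym (ℕP.+-suc k d)) (+-comm k (suc d))) (ℕP.+-monoˡ-≤ d k<z))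

  xHigh-m : ∀ m t z → z ≤ m → z ℕ.+ m ≤ t → xHigh m t z ≡ m ℕ.∸ z
  xHigh-m m t z z≤m z+m≤t = ℕP.m≤n⇒m⊓n≡m (ℕP.m+n≤o⇒m≤o∸n (m ℕ.∸ z) le)
    where
    le : m ℕ.∸ z ℕ.+ (z ℕ.+ z) ≤ t
    le = subst (_≤ t) (sym (trans (sym (+-assoc (m ℕ.∸ z) z z)) (trans (cong (ℕ._+ z) (ℕP.m∸n+n≡m z≤m)) (+-comm m z)))) z+m≤t

  xHigh-t : ∀ m t z → z ℕ.+ z ≤ t → t ≤ m ℕ.+ z → xHigh m t z ≡ t ℕ.∸ (z ℕ.+ z)
  xHigh-t m t z zz≤t t≤m+z = ℕP.m≥n⇒m⊓n≡n (ℕP.m+n≤o⇒m≤o∸n (t ℕ.∸ (z ℕ.+ z)) le)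
    where
    le : t ℕ.∸ (z ℕ.+ z) ℕ.+ z ≤ m
    le = ℕP.+-cancelʳ-≤ z _ m (subst (_≤ m ℕ.+ z) (sym (trans (+-assoc (t ℕ.∸ (z ℕ.+ z)) z z) (ℕP.m∸n+n≡m zz≤t))) t≤m+z)

  xLow-value : ∀ k t z → z ℕ.+ k ≤ t → + xLow k t z ≡ + t - + z - + k
  xLow-value k t z z+k≤t =
    trans (pos-∸ (ℕP.m+n≤o⇒m≤o∸n k (subst (_≤ t) (+-comm z k) z+k≤t))) (cong (_- + k) (pos-∸ (ℕP.m+n≤o⇒m≤o z z+k≤t)))

  xLow-zero : ∀ k t z → t ≤ z ℕ.+ k → xLow k t z ≡ 0
  xLow-zero k t z t≤z+k = ℕP.m≤n⇒m∸n≡0 (ℕP.m≤n+o⇒m∸n≤o t z t≤z+k)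

  -- On the three ranges of z where xHigh and xLow are given by different branches, the slice
  -- is affine in z with slopes 0, −1, −2.
  slice-flat : ∀ m n k t z → T (admissible m n t z) → z ℕ.+ m ≤ t → z ℕ.+ k ≤ t → t ≤ m ℕ.+ k →
    + slice m n k t z ≡ (+ m + + k - + t + + 1) + + 0 * + z
  slice-flat m n k t z adm z+m≤t z+k≤t t≤m+k = begin
    + slice m n k t z
      ≡⟨ slice-value m n k t z adm xLow≤1+xHigh ⟩
    + 1 + + xHigh m t z - + xLow k t z
      ≡⟨ cong₂ (λ u v → + 1 + u - v) (trans (cong +_ xHigh≡) (pos-∸ z≤m)) (xLow-value k t z z+k≤t) ⟩
    + 1 + (+ m - + z) - (+ t - + z - + k)
      ≡⟨ affine (+ m) (+ k) (+ t) (+ z) ⟩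
    (+ m + + k - + t + + 1) + + 0 * + z ∎
    where
    open ≡-Reasoning
    affine : ∀ m k t z → + 1 + (m - z) - (t - z - k) ≡ (m + k - t + + 1) + + 0 * z
    affine = solve-∀
    z≤m : z ≤ m
    z≤m = proj₁ (proj₂ (admissible-elim {m} {n} {t} {z} adm))
    xHigh≡ : xHigh m t z ≡ m ℕ.∸ z
    xHigh≡ = xHigh-m m t z z≤m z+m≤t
    t≤z+[k+[m∸z]] : t ≤ z ℕ.+ (k ℕ.+ (m ℕ.∸ z))
    t≤z+[k+[m∸z]] = subst (t ≤_) (regroup m k z z≤m) t≤m+k
      where
      regroup : ∀ m k z → z ≤ m → m ℕ.+ k ≡ z ℕ.+ (k ℕ.+ (m ℕ.∸ z))
      regroup m k z z≤m = begin
        m ℕ.+ k                      ≡⟨ cong (ℕ._+ k) (sym (ℕP.m+[n∸m]≡n z≤m)) ⟩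
        z ℕ.+ (m ℕ.∸ z) ℕ.+ k        ≡⟨ +-assoc z (m ℕ.∸ z) k ⟩
        z ℕ.+ ((m ℕ.∸ z) ℕ.+ k)      ≡⟨ cong (z ℕ.+_) (+-comm (m ℕ.∸ z) k) ⟩
        z ℕ.+ (k ℕ.+ (m ℕ.∸ z))      ∎
    xLow≤1+xHigh : xLow k t z ≤ suc (xHigh m t z)
    xLow≤1+xHigh = subst (λ u → xLow k t z ≤ suc u) (sym xHigh≡)
      (ℕP.m≤n⇒m≤1+n (ℕP.m≤n+o⇒m∸n≤o (t ℕ.∸ z) k (ℕP.m≤n+o⇒m∸n≤o t z t≤z+[k+[m∸z]])))

  slice-slope₁ : ∀ m n k t z → T (admissible m n t z) → z ≤ k → t ≤ m ℕ.+ z → z ℕ.+ k ≤ t →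
    + slice m n k t z ≡ (+ k + + 1) + (- + 1) * + z
  slice-slope₁ m n k t z adm z≤k t≤m+z z+k≤t = begin
    + slice m n k t z
      ≡⟨ slice-value m n k t z adm xLow≤1+xHigh ⟩
    + 1 + + xHigh m t z - + xLow k t z
      ≡⟨ cong₂ (λ u v → + 1 + u - v) (trans (cong +_ xHigh≡) (pos-∸ zz≤t)) (xLow-value k t z z+k≤t) ⟩
    + 1 + (+ t - (+ z + + z)) - (+ t - + z - + k)
      ≡⟨ affine (+ k) (+ t) (+ z) ⟩
    (+ k + + 1) + (- + 1) * + z ∎
    where
    open ≡-Reasoning
    affine : ∀ k t z → + 1 + (t - (z + z)) - (t - z - k) ≡ (k + + 1) + (- + 1) * z
    affine = solve-∀
    zz≤t : z ℕ.+ z ≤ t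
    zz≤t = proj₁ (admissible-elim {m} {n} {t} {z} adm)
    xHigh≡ : xHigh m t z ≡ t ℕ.∸ (z ℕ.+ z)
    xHigh≡ = xHigh-t m t z zz≤t t≤m+z
    xLow≤1+xHigh : xLow k t z ≤ suc (xHigh m t z)
    xLow≤1+xHigh = subst (λ u → xLow k t z ≤ suc u) (sym xHigh≡)
      (ℕP.m≤n⇒m≤1+n (≤-trans (ℕP.∸-monoʳ-≤ (t ℕ.∸ z) z≤k) (ℕP.≤-reflexive (ℕP.∸-+-assoc t z z))))

  slice-slope₂ : ∀ m n k t z → T (admissible m n t z) → t ≤ m ℕ.+ z → t ≤ z ℕ.+ k →
    + slice m n k t z ≡ (+ t + + 1) + (- + 2) * + z
  slice-slope₂ m n k t z adm t≤m+z t≤z+k = begin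
    + slice m n k t z
      ≡⟨ slice-value m n k t z adm (subst (_≤ suc (xHigh m t z)) (sym xLow≡0) z≤n) ⟩
    + 1 + + xHigh m t z - + xLow k t z
      ≡⟨ cong₂ (λ u v → + 1 + u - + v) (trans (cong +_ (xHigh-t m t z zz≤t t≤m+z)) (pos-∸ zz≤t)) xLow≡0 ⟩
    + 1 + (+ t - (+ z + + z)) - + 0
      ≡⟨ affine (+ t) (+ z) ⟩
    (+ t + + 1) + (- + 2) * + z ∎
    where
    open ≡-Reasoning
    affine : ∀ t z → + 1 + (t - (z + z)) - + 0 ≡ (t + + 1) + (- + 2) * z
    affine = solve-∀
    zz≤t : z ℕ.+ z ≤ t
    zz≤t = proj₁ (admissible-elim {m} {n} {t} {z} adm)
    xLow≡0 : xLow k t z ≡ 0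
    xLow≡0 = xLow-zero k t z t≤z+k

  -- z ranges over [t − n, Z]: below t − n the slice is inadmissible and above Z it is empty.
  -- The breakpoints c₁ ≤ c₂ separate the flat range, the slope −1 range and the slope −2 range.
  twice-∑-slices : ∀ m n k t c₁ c₂ Z →
    t ℕ.∸ n ≤ c₁ → c₁ ≤ c₂ → c₂ ≤ suc Z → Z ℕ.+ Z ≤ t → Z ≤ m → Z ≤ k →
    (∀ z → Z < z → z ℕ.+ z ≤ t → z ≤ m → k < z) →
    t ≤ m ℕ.+ k → t ≤ m ℕ.+ c₁ →
    (∀ z → t ℕ.∸ n ≤ z → z < c₁ → z ℕ.+ m ≤ t × z ℕ.+ k ≤ t) →
    (∀ z → c₁ ≤ z → z < c₂ → z ℕ.+ k ≤ t) →
    (∀ z → c₂ ≤ z → z ≤ Z → t ≤ z ℕ.+ k) →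
    + 2 * + ∑ (suc (m ℕ.+ n ℕ.+ k)) (slice m n k t) ≡
      twiceArithSum (+ c₁ - + (t ℕ.∸ n)) (+ m + + k - + t + + 1) (+ 0) (+ (t ℕ.∸ n))
      + (twiceArithSum (+ c₂ - + c₁) (+ k + + 1) (- + 1) (+ c₁)
      + twiceArithSum (+ 1 + + Z - + c₂) (+ t + + 1) (- + 2) (+ c₂))
  twice-∑-slices m n k t c₁ c₂ Z F≤c₁ c₁≤c₂ c₂≤1+Z ZZ≤t Z≤m Z≤k beyond-Z t≤m+k t≤m+c₁ range₁ range₂ range₃ =
    trans (cong (λ u → + 2 * + u) (∑-window N F (suc Z ℕ.∸ F) (slice m n k t) window≤N below above))
          (∑-piecewise-affine F c₁ c₂ (suc Z) (slice m n k t)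
            (+ m + + k - + t + + 1) (+ 0) (+ k + + 1) (- + 1) (+ t + + 1) (- + 2) F≤c₁ c₁≤c₂ c₂≤1+Z
            (λ z F≤z z<c₁ → let z+m≤t , z+k≤t = range₁ z F≤z z<c₁ in
               slice-flat m n k t z (adm F≤z (up₁ z<c₁)) z+m≤t z+k≤t t≤m+k)
            (λ z c₁≤z z<c₂ → slice-slope₁ m n k t z (adm (≤-trans F≤c₁ c₁≤z) (up₂ z<c₂)) (≤-trans (up₂ z<c₂) Z≤k)
               (≤-trans t≤m+c₁ (ℕP.+-monoʳ-≤ m c₁≤z)) (range₂ z c₁≤z z<c₂))
            (λ z c₂≤z z≤Z → slice-slope₂ m n k t z (adm (≤-trans F≤c₁ (≤-trans c₁≤c₂ c₂≤z)) (ℕP.≤-pred z≤Z))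
               (≤-trans t≤m+c₁ (ℕP.+-monoʳ-≤ m (≤-trans c₁≤c₂ c₂≤z))) (range₃ z c₂≤z (ℕP.≤-pred z≤Z))))
    where
    N = suc (m ℕ.+ n ℕ.+ k)
    F = t ℕ.∸ n
    F≤1+Z : F ≤ suc Z
    F≤1+Z = ≤-trans F≤c₁ (≤-trans c₁≤c₂ c₂≤1+Z)
    window≤N : F ℕ.+ (suc Z ℕ.∸ F) ≤ N
    window≤N = subst (_≤ N) (sym (ℕP.m+[n∸m]≡n F≤1+Z))
                 (s≤s (≤-trans Z≤k (m≤n+m k (m ℕ.+ n))))
    up₁ : ∀ {z} → z < c₁ → z ≤ Z
    up₁ z<c₁ = ℕP.≤-pred (≤-trans z<c₁ (≤-trans c₁≤c₂ c₂≤1+Z))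
    up₂ : ∀ {z} → z < c₂ → z ≤ Z
    up₂ z<c₂ = ℕP.≤-pred (≤-trans z<c₂ c₂≤1+Z)
    adm : ∀ {z} → F ≤ z → z ≤ Z → T (admissible m n t z)
    adm {z} F≤z z≤Z = admissible-intro (≤-trans (ℕP.+-mono-≤ z≤Z z≤Z) ZZ≤t) (≤-trans z≤Z Z≤m)
                        (≤-trans (ℕP.m≤n+m∸n t n) (ℕP.+-monoʳ-≤ n F≤z))
    below : ∀ z → z < F → slice m n k t z ≡ 0
    below z z<F = slice-inadmissible m n k t z λ a →
      ℕP.<⇒≱ z<F (ℕP.m≤n+o⇒m∸n≤o t n (proj₂ (proj₂ (admissible-elim {m} {n} {t} {z} a))))
    above : ∀ z → F ℕ.+ (suc Z ℕ.∸ F) ≤ z → slice m n k t z ≡ 0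
    above z h with (z ℕ.+ z) ℕ.≤? t | z ℕ.≤? m
    ... | yes zz≤t | yes z≤m = slice-beyond-k m n k t z zz≤t (beyond-Z z (subst (_≤ z) (ℕP.m+[n∸m]≡n F≤1+Z) h) zz≤t z≤m)
    ... | no zz≰t | _ = slice-inadmissible m n k t z (λ a → zz≰t (proj₁ (admissible-elim {m} {n} {t} {z} a)))
    ... | yes _ | no z≰m = slice-inadmissible m n k t z (λ a → z≰m (proj₁ (proj₂ (admissible-elim {m} {n} {t} {z} a))))


module IntegerFacts where

  open import Data.Nat as ℕ using (ℕ; zero; suc; z≤n; s≤s)
  import Data.Nat.Properties as ℕP
  import Data.Nat.DivMod as ℕD
  open import Data.Integer using (ℤ; +_; -[1+_]; _+_; _-_; _*_; -_; _⊔_; _≤_; _≤ᵇ_; +≤+)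
  import Data.Integer.Properties as ℤP
  open import Data.Integer.DivMod using (_/ℕ_; _%ℕ_; a≡a%ℕn+[a/ℕn]*n; n%ℕd<d)
  open import Data.Bool using (true; false; T; if_then_else_)
  open import Data.Product using (Σ; _,_; proj₂)
  open import Data.Empty using (⊥-elim)
  open import Relation.Nullary using (¬_; yes; no)
  open import Relation.Binary.PropositionalEquality
  open import Data.Integer.Tactic.RingSolver
  import Data.Nat.Tactic.RingSolver as ℕ-Solver
  open import Defs using (half; fl2; md2; ce2; _<ᶻ_)
  open ArithmeticSums using (pos-∸)

  if-T : ∀ {A : Set} {b} {x y : A} → T b → (if b then x else y) ≡ x
  if-T {b = true} _ = refl

  if-¬T : ∀ {A : Set} {b} {x y : A} → ¬ T b → (if b then x else y) ≡ y
  if-¬T {b = true} h = ⊥-elim (h _)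
  if-¬T {b = false} _ = refl

  Even : ℤ → Set
  Even P = Σ ℤ (λ W → P ≡ + 2 * W)

  double≢1 : ∀ x → + 2 * x ≢ + 1
  double≢1 (+ zero) ()
  double≢1 (+ suc a) e with ℤP.+-injective (trans (ℤP.pos-* 2 (suc a)) e)
  ... | 2+2a≡1 = ℕP.m+1+n≢0 a (ℕP.suc-injective 2+2a≡1)
  double≢1 -[1+ a ] ()

  half-double : ∀ W → half (+ 2 * W) ≡ W
  half-double W with (+ 2 * W) %ℕ 2 | a≡a%ℕn+[a/ℕn]*n (+ 2 * W) 2 | n%ℕd<d (+ 2 * W) 2
  ... | zero | e | _ = sym (ℤP.*-cancelˡ-≡ (+ 2) W q (trans e (reorder q)))
    where
    q = (+ 2 * W) /ℕ 2
    reorder : ∀ q → + 0 + q * + 2 ≡ + 2 * q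
    reorder = solve-∀
  ... | suc zero | e | _ = ⊥-elim (double≢1 (W - q) (trans (expand W q) (trans (cong (_- q * + 2) e) (cancel q))))
    where
    q = (+ 2 * W) /ℕ 2
    expand : ∀ W q → + 2 * (W - q) ≡ + 2 * W - q * + 2
    expand = solve-∀
    cancel : ∀ q → + 1 + q * + 2 - q * + 2 ≡ + 1
    cancel = solve-∀
  ... | suc (suc r) | _ | s≤s (s≤s ())

  double-half : ∀ P → Even P → + 2 * half P ≡ P
  double-half P (W , refl) = cong (+ 2 *_) (half-double W)

  half-+-double : ∀ S P Q → + 2 * S ≡ P + + 2 * Q → Even P → S ≡ half P + Q
  half-+-double S P Q e ev = ℤP.*-cancelˡ-≡ (+ 2) S (half P + Q)
    (trans e (trans (cong (_+ + 2 * Q) (sym (double-half P ev))) (distrib (half P) Q)))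
    where
    distrib : ∀ h q → + 2 * h + + 2 * q ≡ + 2 * (h + q)
    distrib = solve-∀

  triangle : ℕ → ℕ
  triangle zero = 0
  triangle (suc n) = suc n ℕ.+ triangle n

  triangle-double : ∀ n → n ℕ.* suc n ≡ 2 ℕ.* triangle n
  triangle-double zero = refl
  triangle-double (suc n) = trans (peel n) (trans (cong (λ u → suc n ℕ.+ suc n ℕ.+ u) (triangle-double n)) (regroup n (triangle n)))
    where
    peel : ∀ n → suc n ℕ.* suc (suc n) ≡ suc n ℕ.+ suc n ℕ.+ n ℕ.* suc n
    peel = ℕ-Solver.solve-∀
    regroup : ∀ n s → suc n ℕ.+ suc n ℕ.+ 2 ℕ.* s ≡ 2 ℕ.* (suc n ℕ.+ s)
    regroup = ℕ-Solver.solve-∀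

  even-consecutive : ∀ a → Even (a * (a + + 1))
  even-consecutive (+ n) = + triangle n ,
    trans (sym (trans (ℤP.pos-* n (suc n)) (cong (λ u → + n * + u) (ℕP.+-comm 1 n))))
          (trans (cong +_ (triangle-double n)) (ℤP.pos-* 2 (triangle n)))
  even-consecutive -[1+ n ] = + triangle n ,
    trans (cong (λ u → u * (u + + 1)) (negsuc n)) (trans (reflect (+ n)) (proj₂ (even-consecutive (+ n))))
    where
    negsuc : ∀ n → -[1+ n ] ≡ - (+ n) - + 1
    negsuc zero = refl
    negsuc (suc n) = cong (λ x → -[1+ suc x ]) (sym (ℕP.+-identityʳ n))
    reflect : ∀ x → (- x - + 1) * ((- x - + 1) + + 1) ≡ x * (x + + 1)
    reflect = solve-∀

  even-≡ : ∀ {a b} → a ≡ b → Even a → Even b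
  even-≡ refl e = e

  even-+ : ∀ {a b} → Even a → Even b → Even (a + b)
  even-+ (W₁ , refl) (W₂ , refl) = W₁ + W₂ , distrib W₁ W₂
    where
    distrib : ∀ x y → + 2 * x + + 2 * y ≡ + 2 * (x + y)
    distrib = solve-∀

  even-neg : ∀ {a} → Even a → Even (- a)
  even-neg (W , refl) = - W , neg W
    where
    neg : ∀ x → - (+ 2 * x) ≡ + 2 * (- x)
    neg = solve-∀

  even-double : ∀ Q → Even (+ 2 * Q)
  even-double Q = Q , refl

  pos-∸-⊔ : ∀ t c → (+ t - + c) ⊔ + 0 ≡ + (t ℕ.∸ c)
  pos-∸-⊔ t c with c ℕ.≤? t
  ... | yes c≤t = trans (cong (_⊔ + 0) (sym (pos-∸ c≤t))) (cong +_ (ℕP.⊔-identityʳ (t ℕ.∸ c)))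
  ... | no c≰t = trans (cong (_⊔ + 0) (trans (ℤP.[+m]-[+n]≡m⊖n t c) (ℤP.⊖-< t<c)))
                       (trans (neg⊔0 (c ℕ.∸ t) (ℕP.m>n⇒m∸n≢0 t<c)) (cong +_ (sym (ℕP.m≤n⇒m∸n≡0 (ℕP.<⇒≤ t<c)))))
    where
    t<c : t ℕ.< c
    t<c = ℕP.≰⇒> c≰t
    neg⊔0 : ∀ d → d ≢ 0 → (- (+ d)) ⊔ + 0 ≡ + 0
    neg⊔0 zero d≢0 = ⊥-elim (d≢0 refl)
    neg⊔0 (suc d) _ = refl

  ≤ᵇ-by : ∀ x y d → y ≡ x + + d → T (x ≤ᵇ y)
  ≤ᵇ-by x y d e = ℤP.≤⇒≤ᵇ (subst (x ≤_) (sym e) (ℤP.i≤i+j x (+ d)))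

  ≰ᵇ-by : ∀ x y d → x ≡ y + + suc d → ¬ T (x ≤ᵇ y)
  ≰ᵇ-by x y d e x≤y with subst₂ _≤_ (cancel y (+ suc d)) (ℤP.+-inverseˡ y)
                           (ℤP.+-monoʳ-≤ (- y) (subst (_≤ y) e (ℤP.≤ᵇ⇒≤ x≤y)))
    where
    cancel : ∀ y a → - y + (y + a) ≡ a
    cancel = solve-∀
  ... | +≤+ ()

  <ᶻ0-by : ∀ a b → suc a ℕ.≤ b → T ((+ a - + b) <ᶻ + 0)
  <ᶻ0-by a b a<b = ≤ᵇ-by (+ a - + b + + 1) (+ 0) (b ℕ.∸ suc a)
    (sym (trans (cong (λ u → + a - + b + + 1 + u) (pos-∸ a<b)) (cancel (+ a) (+ b))))
    where
    cancel : ∀ a b → a - b + + 1 + (b - (+ 1 + a)) ≡ + 0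
    cancel = solve-∀

  ≮ᶻ0-by : ∀ a b → b ℕ.≤ a → ¬ T ((+ a - + b) <ᶻ + 0)
  ≮ᶻ0-by a b b≤a = ≰ᵇ-by (+ a - + b + + 1) (+ 0) (a ℕ.∸ b)
    (trans (comm (+ a) (+ b)) (cong (λ u → + 1 + u) (sym (pos-∸ b≤a))))
    where
    comm : ∀ a b → a - b + + 1 ≡ + 1 + (a - b)
    comm = solve-∀

  record HalfDecomposition (t : ℕ) : Set where
    field
      quot rem : ℕ
      t≡ : t ≡ rem ℕ.+ quot ℕ.* 2
      rem≤1 : rem ℕ.≤ 1
      fl2≡ : fl2 (+ t) ≡ + quot
      md2≡ : md2 (+ t) ≡ + rem
      ce2≡ : ce2 (+ t) ≡ + (quot ℕ.+ rem)

  halfDecomposition : ∀ t → HalfDecomposition t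
  halfDecomposition t with t ℕ.% 2 in t%2≡ | ℕD.m≡m%n+[m/n]*n t 2 | ℕD.m%n<n t 2
  ... | zero | t≡ | _ = record
    { quot = q ; rem = 0 ; t≡ = t≡ ; rem≤1 = z≤n ; fl2≡ = refl ; md2≡ = cong +_ t%2≡ ; ce2≡ = cong +_ ceil≡ }
    where
    q = t ℕ./ 2
    ceil≡ : (t ℕ.+ 1) ℕ./ 2 ≡ q ℕ.+ 0
    ceil≡ = trans (cong (λ u → (u ℕ.+ 1) ℕ./ 2) t≡)
              (trans (ℕD.+-distrib-/ (q ℕ.* 2) 1 (subst (λ u → u ℕ.+ 1 ℕ.< 2) (sym (ℕD.m*n%n≡0 q 2)) (s≤s (s≤s z≤n))))
              (trans (cong (ℕ._+ 0) (ℕD.m*n/n≡m q 2)) refl))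
  ... | suc zero | t≡ | _ = record
    { quot = q ; rem = 1 ; t≡ = t≡ ; rem≤1 = ℕP.≤-refl ; fl2≡ = refl ; md2≡ = cong +_ t%2≡ ; ce2≡ = cong +_ ceil≡ }
    where
    q = t ℕ./ 2
    ceil≡ : (t ℕ.+ 1) ℕ./ 2 ≡ q ℕ.+ 1
    ceil≡ = trans (cong (λ u → (u ℕ.+ 1) ℕ./ 2) t≡)
              (trans (cong (ℕ._/ 2) (cong suc (ℕP.+-comm (q ℕ.* 2) 1))) (trans (ℕD.m*n/n≡m (suc q) 2) (ℕP.+-comm 1 q)))
  ... | suc (suc _) | _ | s≤s (s≤s ())

  +-self-≤-suc : ∀ {a b} → a ℕ.+ a ℕ.≤ suc (b ℕ.+ b) → a ℕ.≤ b
  +-self-≤-suc {a} {b} h with a ℕ.≤? b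
  ... | yes a≤b = a≤b
  ... | no a≰b = ⊥-elim (ℕP.<⇒≱ (ℕP.≤-trans (s≤s (ℕP.≤-reflexive (sym (ℕP.+-suc b b)))) (ℕP.+-mono-≤ b<a b<a)) h)
    where b<a = ℕP.≰⇒> a≰b

  module _ {t : ℕ} (P : HalfDecomposition t) where
    open HalfDecomposition P

    quot+quot≤t : quot ℕ.+ quot ℕ.≤ t
    quot+quot≤t = subst (quot ℕ.+ quot ℕ.≤_) (sym t≡)
      (subst (ℕ._≤ rem ℕ.+ quot ℕ.* 2) (double quot) (ℕP.m≤n+m (quot ℕ.* 2) rem))
      where
      double : ∀ q → q ℕ.* 2 ≡ q ℕ.+ q
      double = ℕ-Solver.solve-∀

    quot-maximal : ∀ z → z ℕ.+ z ℕ.≤ t → z ℕ.≤ quot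
    quot-maximal z zz≤t with z ℕ.≤? quot
    ... | yes z≤q = z≤q
    ... | no z≰q = ⊥-elim (ℕP.<⇒≱ t<zz zz≤t)
      where
      q<z : quot ℕ.< z
      q<z = ℕP.≰⇒> z≰q
      t<zz : t ℕ.< z ℕ.+ z
      t<zz = subst (ℕ._< z ℕ.+ z) (sym t≡)
        (ℕP.≤-trans (s≤s (ℕP.+-monoˡ-≤ (quot ℕ.* 2) rem≤1)) (subst (ℕ._≤ z ℕ.+ z) (regroup quot) (ℕP.+-mono-≤ q<z q<z)))
        where
        regroup : ∀ q → suc q ℕ.+ suc q ≡ suc (1 ℕ.+ q ℕ.* 2)
        regroup = ℕ-Solver.solve-∀

    quot+rem≤ : ∀ n → t ℕ.≤ n ℕ.+ n → quot ℕ.+ rem ℕ.≤ n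
    quot+rem≤ n t≤2n = +-self-≤-suc (subst (ℕ._≤ suc (n ℕ.+ n)) (regroup quot rem) (ℕP.+-mono-≤ rem≤1 (subst (ℕ._≤ n ℕ.+ n) t≡ t≤2n)))
      where
      regroup : ∀ q r → r ℕ.+ (r ℕ.+ q ℕ.* 2) ≡ q ℕ.+ r ℕ.+ (q ℕ.+ r)
      regroup = ℕ-Solver.solve-∀

    rem²≡rem : + rem * + rem ≡ + rem
    rem²≡rem with rem | rem≤1
    ... | zero | _ = refl
    ... | suc zero | _ = refl
    ... | suc (suc _) | s≤s ()

    pos-t : + t ≡ + rem + + quot * + 2
    pos-t = trans (cong +_ t≡) (trans (ℤP.pos-+ rem (quot ℕ.* 2)) (cong (λ u → + rem + u) (ℤP.pos-* quot 2)))


module PartI where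

  open import Data.Nat as ℕ using (ℕ; suc; _≤_)
  open import Data.Nat.Properties as ℕP using (≤-trans; ≤-refl; m≤m+n; +-comm)
  open import Data.Integer using (+_; _+_; _-_; _*_; -_; _⊓_; _⊔_)
  import Data.Integer.Properties as ℤP
  open import Data.Empty using (⊥-elim)
  open import Relation.Binary.PropositionalEquality
  open import Data.Integer.Tactic.RingSolver
  import Data.Nat.Tactic.RingSolver as ℕ-Solver
  open import Defs
  open FiniteSums
  open Slices
  open ArithmeticSums
  open SliceRegions
  open IntegerFacts

  ⊓-minus : ∀ a x → a ⊓ (a - x) ≡ a - (x ⊔ + 0)
  ⊓-minus a x = sym (begin
    a - (x ⊔ + 0)                ≡⟨ cong (λ u → a + u) (ℤP.neg-distrib-⊔-⊓ x (+ 0)) ⟩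
    a + (- x ⊓ + 0)              ≡⟨ ℤP.mono-≤-distrib-⊓ (ℤP.+-monoʳ-≤ a) (- x) (+ 0) ⟩
    (a - x) ⊓ (a + + 0)          ≡⟨ cong ((a - x) ⊓_) (ℤP.+-identityʳ a) ⟩
    (a - x) ⊓ a                  ≡⟨ ℤP.⊓-comm (a - x) a ⟩
    a ⊓ (a - x)                  ∎)
    where open ≡-Reasoning

  module _ {t : ℕ} (P : HalfDecomposition t) where
    open HalfDecomposition P renaming (quot to H; rem to r)

    coeff1-via-halves : ∀ n → coeff1 n (+ t) ≡ (+ H - + (t ℕ.∸ n) + + 1) * (+ H - + (t ℕ.∸ n) + + r + + 1)
    coeff1-via-halves n = cong₂ (λ L d → (L + + 1) * (L + d + + 1)) (trans (cong₂ (λ a b → a ⊓ (+ n - b)) fl2≡ ce2≡) L≡) md2≡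
      where
      open ≡-Reasoning
      rewrite-n : ∀ N Q R → N - (Q + R) ≡ Q - ((R + Q * + 2) - N)
      rewrite-n = solve-∀
      L≡ : + H ⊓ (+ n - + (H ℕ.+ r)) ≡ + H - + (t ℕ.∸ n)
      L≡ = begin
        + H ⊓ (+ n - + (H ℕ.+ r))    ≡⟨ cong (λ u → + H ⊓ (+ n - u)) (ℤP.pos-+ H r) ⟩
        + H ⊓ (+ n - (+ H + + r))    ≡⟨ cong (λ u → + H ⊓ u) (rewrite-n (+ n) (+ H) (+ r)) ⟩
        + H ⊓ (+ H - ((+ r + + H * + 2) - + n))
                                     ≡⟨ cong (λ u → + H ⊓ (+ H - (u - + n))) (sym (pos-t P)) ⟩
        + H ⊓ (+ H - (+ t - + n))    ≡⟨ ⊓-minus (+ H) (+ t - + n) ⟩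
        + H - ((+ t - + n) ⊔ + 0)    ≡⟨ cong (λ u → + H - u) (pos-∸-⊔ t n) ⟩
        + H - + (t ℕ.∸ n)            ∎

  partI-slices : ∀ m n k t → n ≤ m → n ≤ k → t ≤ n ℕ.+ n →
    + ∑ (suc (m ℕ.+ n ℕ.+ k)) (slice m n k t) ≡ coeff1 n (+ t)
  partI-slices m n k t n≤m n≤k t≤2n = ℤP.*-cancelˡ-≡ (+ 2) _ _ (begin
    + 2 * + ∑ (suc (m ℕ.+ n ℕ.+ k)) (slice m n k t)
      ≡⟨ twice-∑-slices m n k t F F H ≤-refl ≤-refl (ℕP.m≤n⇒m≤1+n F≤H) (quot+quot≤t P) (≤-trans H≤n n≤m) (≤-trans H≤n n≤k)
           (λ z H<z zz≤t _ → ⊥-elim (ℕP.<⇒≱ H<z (quot-maximal P z zz≤t)))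
           (≤-trans t≤2n (ℕP.+-mono-≤ n≤m n≤k)) (≤-trans (ℕP.m≤n+m∸n t n) (ℕP.+-monoˡ-≤ F n≤m))
           (λ z F≤z z<F → ⊥-elim (ℕP.<⇒≱ z<F F≤z)) (λ z F≤z z<F → ⊥-elim (ℕP.<⇒≱ z<F F≤z))
           (λ z F≤z _ → subst (t ≤_) (+-comm k z) (≤-trans (ℕP.m≤n+m∸n t n) (ℕP.+-mono-≤ n≤k F≤z))) ⟩
    twiceArithSum (+ F - + F) (+ m + + k - + t + + 1) (+ 0) (+ F)
      + (twiceArithSum (+ F - + F) (+ k + + 1) (- + 1) (+ F) + twiceArithSum (+ 1 + + H - + F) (+ t + + 1) (- + 2) (+ F))
      ≡⟨ cong (λ u → twiceArithSum (+ F - + F) (+ m + + k - u + + 1) (+ 0) (+ F)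
                      + (twiceArithSum (+ F - + F) (+ k + + 1) (- + 1) (+ F) + twiceArithSum (+ 1 + + H - + F) (u + + 1) (- + 2) (+ F)))
              (pos-t P) ⟩
    _
      ≡⟨ evaluate (+ m) (+ k) (+ H) (+ F) (+ r) ⟩
    + 2 * ((+ H - + F + + 1) * (+ H - + F + + r + + 1))
      ≡⟨ cong (+ 2 *_) (sym (coeff1-via-halves P n)) ⟩
    + 2 * coeff1 n (+ t) ∎)
    where
    open ≡-Reasoning
    P = halfDecomposition t
    open HalfDecomposition P renaming (quot to H; rem to r)
    F = t ℕ.∸ n
    H+r≤n : H ℕ.+ r ≤ n
    H+r≤n = quot+rem≤ P n t≤2n
    H≤n : H ≤ n
    H≤n = ≤-trans (m≤m+n H r) H+r≤n
    F≤H : F ≤ H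
    F≤H = ℕP.m≤n+o⇒m∸n≤o t n (subst (_≤ n ℕ.+ H) (trans (regroup H r) (sym t≡)) (ℕP.+-monoˡ-≤ H H+r≤n))
      where
      regroup : ∀ q ρ → q ℕ.+ ρ ℕ.+ q ≡ ρ ℕ.+ q ℕ.* 2
      regroup = ℕ-Solver.solve-∀
    -- solve-∀ does not unfold twiceArithSum, so its body is restated as seg in these identities.
    evaluate : ∀ M K Q F R → let T = R + Q * + 2; seg = λ l A B c → + 2 * l * A + B * (l * (+ 2 * c + l - + 1)) in
      seg (F - F) (M + K - T + + 1) (+ 0) F + (seg (F - F) (K + + 1) (- + 1) F + seg (+ 1 + Q - F) (T + + 1) (- + 2) F)
      ≡ + 2 * ((Q - F + + 1) * (Q - F + R + + 1))
    evaluate = solve-∀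


module PartII where

  open import Data.Nat as ℕ using (ℕ; zero; suc; z≤n; s≤s; _≤_; _<_)
  open import Data.Nat.Properties as ℕP using (≤-trans; ≤-refl; m≤m+n; m≤n+m; +-comm)
  open import Data.Integer as ℤ using (ℤ; +_; _+_; _-_; _*_; -_; _⊓_; _⊔_)
  import Data.Integer.Properties as ℤP
  open import Data.Integer.DivMod using (_%ℕ_)
  open import Data.Bool using (T; if_then_else_)
  open import Data.Empty using (⊥-elim)
  open import Relation.Nullary using (¬_; yes; no)
  open import Relation.Binary.PropositionalEquality hiding (J)
  open import Data.Integer.Tactic.RingSolver
  import Data.Nat.Tactic.RingSolver as ℕ-Solver
  open import Defs
  open FiniteSums
  open Slices
  open ArithmeticSums
  open SliceRegions
  open IntegerFacts

  coeff23′ : ℤ → ℤ → ℤ → ℤ → ℤ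
  coeff23′ s F₂ F₁ ρ =
    let J = s - F₂ - ρ
        L = F₂ - F₁
    in if J <ᶻ + 0
       then half ((L + + 1) * (+ 2 * s - + 2 * F₂ + L + + 2))
       else if J ≤ᶻ L
       then half ((L + + 1) * (L + + 2) - F₂ * (F₂ + + 1) - s * (s - + 1))
            + F₂ * s + s * L - F₂ * L + (s - F₂) * ρ
       else (L + + 1) * (L + ρ + + 1)

  coeff23≡coeff23′ : ∀ s n t F₂ F₁ ρ → fl2 t ⊓ + s ≡ F₂ → (t - + n) ⊔ + 0 ≡ F₁ → t %ℕ 2 ≡ ρ →
    coeff23 s n t ≡ coeff23′ (+ s) F₂ F₁ (+ ρ)
  coeff23≡coeff23′ s n t F₂ F₁ ρ refl refl refl = refl

  even-diff₃ : ∀ a b c → Even (a * (a + + 1) - b * (b + + 1) - c * (c + + 1))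
  even-diff₃ a b c = even-+ (even-+ (even-consecutive a) (even-neg (even-consecutive b))) (even-neg (even-consecutive c))

  -- k ≤ ⌊t/2⌋: only the slope −1 range [t − n, k] contributes.
  twice-∑-slices-k≤quot : ∀ m n k t → n ≤ m → k ≤ n → t ≤ n ℕ.+ k → k ℕ.+ k ≤ t →
    + 2 * + ∑ (suc (m ℕ.+ n ℕ.+ k)) (slice m n k t) ≡ (+ k - + (t ℕ.∸ n) + + 1) * (+ k - + (t ℕ.∸ n) + + 2)
  twice-∑-slices-k≤quot m n k t n≤m k≤n t≤n+k 2k≤t = begin
    + 2 * + ∑ (suc (m ℕ.+ n ℕ.+ k)) (slice m n k t)
      ≡⟨ twice-∑-slices m n k t F (suc k) k ≤-refl (ℕP.m≤n⇒m≤1+n F≤k) ≤-refl 2k≤t (≤-trans k≤n n≤m) ≤-refl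
           (λ z k<z _ _ → k<z) (≤-trans t≤n+k (ℕP.+-monoˡ-≤ k n≤m)) (≤-trans (ℕP.m≤n+m∸n t n) (ℕP.+-monoˡ-≤ F n≤m))
           (λ z F≤z z<F → ⊥-elim (ℕP.<⇒≱ z<F F≤z))
           (λ z _ z≤k → ≤-trans (ℕP.+-monoˡ-≤ k (ℕP.≤-pred z≤k)) 2k≤t)
           (λ z k<z z≤k → ⊥-elim (ℕP.<⇒≱ k<z z≤k)) ⟩
    twiceArithSum (+ F - + F) (+ m + + k - + t + + 1) (+ 0) (+ F)
      + (twiceArithSum (+ suc k - + F) (+ k + + 1) (- + 1) (+ F)
      + twiceArithSum (+ 1 + + k - + suc k) (+ t + + 1) (- + 2) (+ suc k))
      ≡⟨ evaluate (+ m) (+ k) (+ t) (+ F) ⟩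
    (+ k - + F + + 1) * (+ k - + F + + 2) ∎
    where
    open ≡-Reasoning
    F = t ℕ.∸ n
    F≤k : F ≤ k
    F≤k = ℕP.m≤n+o⇒m∸n≤o t n t≤n+k
    evaluate : ∀ M K T F → let seg = λ l A B c → + 2 * l * A + B * (l * (+ 2 * c + l - + 1)) in
      seg (F - F) (M + K - T + + 1) (+ 0) F
        + (seg (+ 1 + K - F) (K + + 1) (- + 1) F + seg (+ 1 + K - (+ 1 + K)) (T + + 1) (- + 2) (+ 1 + K))
      ≡ (K - F + + 1) * (K - F + + 2)
    evaluate = solve-∀

  coeff23′-J<0 : ∀ s F₂ F₁ ρ → T ((s - F₂ - ρ) <ᶻ + 0) →
    coeff23′ s F₂ F₁ ρ ≡ half ((F₂ - F₁ + + 1) * (+ 2 * s - + 2 * F₂ + (F₂ - F₁) + + 2))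
  coeff23′-J<0 s F₂ F₁ ρ J<0 = if-T J<0

  coeff23′-J≤L : ∀ s F₂ F₁ ρ → ¬ T ((s - F₂ - ρ) <ᶻ + 0) → T ((s - F₂ - ρ) ≤ᶻ (F₂ - F₁)) →
    coeff23′ s F₂ F₁ ρ ≡ let L = F₂ - F₁ in
      half ((L + + 1) * (L + + 2) - F₂ * (F₂ + + 1) - s * (s - + 1)) + F₂ * s + s * L - F₂ * L + (s - F₂) * ρ
  coeff23′-J≤L s F₂ F₁ ρ J≮0 J≤L = trans (if-¬T J≮0) (if-T J≤L)

  coeff23′-L<J : ∀ s F₂ F₁ ρ → ¬ T ((s - F₂ - ρ) <ᶻ + 0) → ¬ T ((s - F₂ - ρ) ≤ᶻ (F₂ - F₁)) →
    coeff23′ s F₂ F₁ ρ ≡ (F₂ - F₁ + + 1) * (F₂ - F₁ + ρ + + 1)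
  coeff23′-L<J s F₂ F₁ ρ J≮0 J≰L = trans (if-¬T J≮0) (if-¬T J≰L)

  partII-k≤quot : ∀ m n k t r → r ≤ 1 → n ≤ m → k ≤ n → t ≤ n ℕ.+ k → k ℕ.+ k ≤ t →
    + ∑ (suc (m ℕ.+ n ℕ.+ k)) (slice m n k t) ≡ coeff23′ (+ k) (+ k) (+ (t ℕ.∸ n)) (+ r)
  partII-k≤quot m n k t (suc zero) _ n≤m k≤n t≤n+k 2k≤t =
    trans (half-+-double _ _ (+ 0) (trans (twice-∑-slices-k≤quot m n k t n≤m k≤n t≤n+k 2k≤t) (as-P (+ k) (+ F)))
            (even-≡ (consecutive (+ k) (+ F)) (even-consecutive (+ k - + F + + 1))))
    (trans (ℤP.+-identityʳ _) (sym (coeff23′-J<0 (+ k) (+ k) (+ F) (+ 1) (≤ᵇ-by (+ k - + k - + 1 + + 1) (+ 0) 0 (J+1≡0 (+ k))))))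
    where
    F = t ℕ.∸ n
    as-P : ∀ K F → (K - F + + 1) * (K - F + + 2) ≡ (K - F + + 1) * (+ 2 * K - + 2 * K + (K - F) + + 2) + + 2 * + 0
    as-P = solve-∀
    consecutive : ∀ K F → (K - F + + 1) * ((K - F + + 1) + + 1) ≡ (K - F + + 1) * (+ 2 * K - + 2 * K + (K - F) + + 2)
    consecutive = solve-∀
    J+1≡0 : ∀ K → + 0 ≡ K - K - + 1 + + 1 + + 0
    J+1≡0 = solve-∀
  partII-k≤quot m n k t zero _ n≤m k≤n t≤n+k 2k≤t =
    trans (half-+-double _ P Q (trans (twice-∑-slices-k≤quot m n k t n≤m k≤n t≤n+k 2k≤t) (as-P+2Q (+ k) (+ F)))
            (even-≡ (as-P (+ k) (+ F)) (even-diff₃ (+ k - + F + + 1) (+ k) (+ k - + 1))))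
    (trans (regroup (half P) (+ k * + k) (+ k * (+ k - + F)) (+ k * (+ k - + F)) ((+ k - + k) * + 0))
      (sym (coeff23′-J≤L (+ k) (+ k) (+ F) (+ 0) (≰ᵇ-by (+ k - + k - + 0 + + 1) (+ 0) 0 (J+1≡1 (+ k)))
            (≤ᵇ-by (+ k - + k - + 0) (+ k - + F) (k ℕ.∸ F) (trans (L≡J+L (+ k) (+ F)) (cong (λ u → + k - + k - + 0 + u) (sym (pos-∸ F≤k))))))))
    where
    F = t ℕ.∸ n
    F≤k : F ≤ k
    F≤k = ℕP.m≤n+o⇒m∸n≤o t n t≤n+k
    P = (+ k - + F + + 1) * (+ k - + F + + 2) - + k * (+ k + + 1) - + k * (+ k - + 1)
    Q = + k * + k + + k * (+ k - + F) - + k * (+ k - + F) + (+ k - + k) * + 0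
    as-P+2Q : ∀ K F → (K - F + + 1) * (K - F + + 2) ≡
      ((K - F + + 1) * (K - F + + 2) - K * (K + + 1) - K * (K - + 1)) + + 2 * (K * K + K * (K - F) - K * (K - F) + (K - K) * + 0)
    as-P+2Q = solve-∀
    as-P : ∀ K F → (K - F + + 1) * ((K - F + + 1) + + 1) - K * (K + + 1) - (K - + 1) * ((K - + 1) + + 1)
                 ≡ (K - F + + 1) * (K - F + + 2) - K * (K + + 1) - K * (K - + 1)
    as-P = solve-∀
    regroup : ∀ h A B C D → h + (A + B - C + D) ≡ h + A + B - C + D
    regroup = solve-∀
    J+1≡1 : ∀ K → K - K - + 0 + + 1 ≡ + 0 + + 1
    J+1≡1 = solve-∀
    L≡J+L : ∀ K F → K - F ≡ K - K - + 0 + (K - F)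
    L≡J+L = solve-∀
  partII-k≤quot m n k t (suc (suc _)) (s≤s ())

  module _ (m n k t : ℕ) (P : HalfDecomposition t) where
    open HalfDecomposition P renaming (quot to H; rem to r)

    private
      F = t ℕ.∸ n
      J = + k - + H - + r
      H+r≤k : H < k → H ℕ.+ r ≤ k
      H+r≤k H<k = ≤-trans (ℕP.+-monoʳ-≤ H rem≤1) (subst (_≤ k) (+-comm 1 H) H<k)
      J≮0 : H < k → ¬ T (J <ᶻ + 0)
      J≮0 H<k = ≰ᵇ-by (J + + 1) (+ 0) (k ℕ.∸ (H ℕ.+ r))
        (trans (shift (+ k) (+ H) (+ r)) (cong (λ u → + 1 + u) (sym (pos-∸ (H+r≤k H<k)))))
        where
        shift : ∀ K Q R → K - Q - R + + 1 ≡ + 1 + (K - (Q + R))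
        shift = solve-∀

    -- t < k: F₁ = 0 and only the slope −2 range [0, ⌊t/2⌋] contributes.
    partII-t<k : n ≤ m → k ≤ n → t < k →
      + ∑ (suc (m ℕ.+ n ℕ.+ k)) (slice m n k t) ≡ coeff23′ (+ k) (+ H) (+ F) (+ r)
    partII-t<k n≤m k≤n t<k = ℤP.*-cancelˡ-≡ (+ 2) _ _ (begin
      + 2 * + ∑ (suc (m ℕ.+ n ℕ.+ k)) (slice m n k t)
        ≡⟨ twice-∑-slices m n k t F F H ≤-refl ≤-refl (subst (_≤ suc H) (sym F≡0) z≤n)
             (quot+quot≤t P) (≤-trans H≤k (≤-trans k≤n n≤m)) H≤k
             (λ z H<z zz≤t _ → ⊥-elim (ℕP.<⇒≱ H<z (quot-maximal P z zz≤t)))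
             (≤-trans (ℕP.<⇒≤ t<k) (m≤n+m k m)) (≤-trans (ℕP.m≤n+m∸n t n) (ℕP.+-monoˡ-≤ F n≤m))
             (λ z F≤z z<F → ⊥-elim (ℕP.<⇒≱ z<F F≤z)) (λ z F≤z z<F → ⊥-elim (ℕP.<⇒≱ z<F F≤z))
             (λ z _ _ → ≤-trans (ℕP.<⇒≤ t<k) (m≤n+m k z)) ⟩
      twiceArithSum (+ F - + F) (+ m + + k - + t + + 1) (+ 0) (+ F)
        + (twiceArithSum (+ F - + F) (+ k + + 1) (- + 1) (+ F) + twiceArithSum (+ 1 + + H - + F) (+ t + + 1) (- + 2) (+ F))
        ≡⟨ cong (λ u → twiceArithSum (+ F - + F) (+ m + + k - u + + 1) (+ 0) (+ F)
                        + (twiceArithSum (+ F - + F) (+ k + + 1) (- + 1) (+ F) + twiceArithSum (+ 1 + + H - + F) (u + + 1) (- + 2) (+ F)))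
                (pos-t P) ⟩
      _
        ≡⟨ evaluate (+ m) (+ k) (+ H) (+ F) (+ r) ⟩
      + 2 * ((+ H - + F + + 1) * (+ H - + F + + r + + 1))
        ≡⟨ cong (+ 2 *_) (sym (coeff23′-L<J (+ k) (+ H) (+ F) (+ r) (J≮0 H<k) (≰ᵇ-by J (+ H - + F) (k ℕ.∸ suc t) J≡))) ⟩
      + 2 * coeff23′ (+ k) (+ H) (+ F) (+ r) ∎)
      where
      open ≡-Reasoning
      F≡0 : F ≡ 0
      F≡0 = ℕP.m≤n⇒m∸n≡0 (≤-trans (ℕP.<⇒≤ t<k) k≤n)
      H<k : H < k
      H<k = ℕP.≤-<-trans (≤-trans (m≤m+n H H) (quot+quot≤t P)) t<k
      H≤k : H ≤ k
      H≤k = ℕP.<⇒≤ H<k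
      evaluate : ∀ M K Q F R → let T = R + Q * + 2; seg = λ l A B c → + 2 * l * A + B * (l * (+ 2 * c + l - + 1)) in
        seg (F - F) (M + K - T + + 1) (+ 0) F + (seg (F - F) (K + + 1) (- + 1) F + seg (+ 1 + Q - F) (T + + 1) (- + 2) F)
        ≡ + 2 * ((Q - F + + 1) * (Q - F + R + + 1))
      evaluate = solve-∀
      J≡ : J ≡ + H - + F + + suc (k ℕ.∸ suc t)
      J≡ = sym (begin
        + H - + F + (+ 1 + + (k ℕ.∸ suc t))   ≡⟨ cong₂ (λ f u → + H - + f + (+ 1 + u)) F≡0 (pos-∸ t<k) ⟩
        + H - + 0 + (+ 1 + (+ k - (+ 1 + + t))) ≡⟨ cong (λ v → + H - + 0 + (+ 1 + (+ k - (+ 1 + v)))) (pos-t P) ⟩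
        _                                       ≡⟨ simplify (+ k) (+ H) (+ r) ⟩
        J                                       ∎)
        where
        simplify : ∀ K Q R → Q - + 0 + (+ 1 + (K - (+ 1 + (R + Q * + 2)))) ≡ K - Q - R
        simplify = solve-∀

    private
      Pₖ = (+ H - + F + + 1) * (+ H - + F + + 2) - + H * (+ H + + 1) - + k * (+ k - + 1)
      Qₖ = + H * + k + + k * (+ H - + F) - + H * (+ H - + F) + (+ k - + H) * + r

      F≤t∸k : k ≤ n → F ≤ t ℕ.∸ k
      F≤t∸k k≤n = ℕP.∸-monoʳ-≤ t k≤n

      twice-∑-slices-k≤t : n ≤ m → k ≤ n → t ≤ n ℕ.+ k → H < k → k ≤ t →
        + 2 * + ∑ (suc (m ℕ.+ n ℕ.+ k)) (slice m n k t) ≡ Pₖ + + 2 * Qₖ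
      twice-∑-slices-k≤t n≤m k≤n t≤n+k H<k k≤t = begin
        + 2 * + ∑ (suc (m ℕ.+ n ℕ.+ k)) (slice m n k t)
          ≡⟨ twice-∑-slices m n k t F (t ℕ.∸ k) H ≤-refl (F≤t∸k k≤n) t∸k≤1+H
               (quot+quot≤t P) (≤-trans (ℕP.<⇒≤ H<k) (≤-trans k≤n n≤m)) (ℕP.<⇒≤ H<k)
               (λ z H<z zz≤t _ → ⊥-elim (ℕP.<⇒≱ H<z (quot-maximal P z zz≤t)))
               (≤-trans t≤n+k (ℕP.+-monoˡ-≤ k n≤m)) (≤-trans (ℕP.m≤n+m∸n t n) (ℕP.+-monoˡ-≤ F n≤m))
               (λ z F≤z z<F → ⊥-elim (ℕP.<⇒≱ z<F F≤z))
               (λ z _ z<t∸k → ≤-trans (ℕP.+-monoˡ-≤ k (ℕP.<⇒≤ z<t∸k)) (ℕP.≤-reflexive (ℕP.m∸n+n≡m k≤t)))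
               (λ z t∸k≤z _ → ≤-trans (ℕP.≤-reflexive (sym (ℕP.m∸n+n≡m k≤t))) (ℕP.+-monoˡ-≤ k t∸k≤z)) ⟩
          twiceArithSum (+ F - + F) (+ m + + k - + t + + 1) (+ 0) (+ F)
            + (twiceArithSum (+ (t ℕ.∸ k) - + F) (+ k + + 1) (- + 1) (+ F)
            + twiceArithSum (+ 1 + + H - + (t ℕ.∸ k)) (+ t + + 1) (- + 2) (+ (t ℕ.∸ k)))
          ≡⟨ cong₂ (λ u c → twiceArithSum (+ F - + F) (+ m + + k - u + + 1) (+ 0) (+ F)
                             + (twiceArithSum (c - + F) (+ k + + 1) (- + 1) (+ F) + twiceArithSum (+ 1 + + H - c) (u + + 1) (- + 2) c))
                   (pos-t P) (trans (pos-∸ k≤t) (cong (_- + k) (pos-t P))) ⟩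
          _
            ≡⟨ evaluate (+ m) (+ k) (+ H) (+ F) (+ r) ⟩
          Pₖ + + 2 * Qₖ + (+ r - + r * + r)
            ≡⟨ cong (λ u → Pₖ + + 2 * Qₖ + (+ r - u)) (rem²≡rem P) ⟩
          Pₖ + + 2 * Qₖ + (+ r - + r)
            ≡⟨ cong (λ u → Pₖ + + 2 * Qₖ + u) (ℤP.+-inverseʳ (+ r)) ⟩
          Pₖ + + 2 * Qₖ + + 0
            ≡⟨ ℤP.+-identityʳ (Pₖ + + 2 * Qₖ) ⟩
          Pₖ + + 2 * Qₖ ∎
        where
        open ≡-Reasoning
        t∸k≤1+H : t ℕ.∸ k ≤ suc H
        t∸k≤1+H = ℕP.m≤n+o⇒m∸n≤o t k (subst (_≤ k ℕ.+ suc H) (sym t≡)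
          (≤-trans (ℕP.+-monoˡ-≤ (H ℕ.* 2) rem≤1) (≤-trans (ℕP.n≤1+n _) (subst (_≤ k ℕ.+ suc H) (regroup H) (ℕP.+-monoˡ-≤ (suc H) H<k)))))
          where
          regroup : ∀ q → suc q ℕ.+ suc q ≡ suc (1 ℕ.+ q ℕ.* 2)
          regroup = ℕ-Solver.solve-∀
        evaluate : ∀ M K Q F R → let T = R + Q * + 2; seg = λ l A B c → + 2 * l * A + B * (l * (+ 2 * c + l - + 1)) in
          seg (F - F) (M + K - T + + 1) (+ 0) F + (seg ((T - K) - F) (K + + 1) (- + 1) F + seg (+ 1 + Q - (T - K)) (T + + 1) (- + 2) (T - K))
          ≡ ((Q - F + + 1) * (Q - F + + 2) - Q * (Q + + 1) - K * (K - + 1))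
            + + 2 * (Q * K + K * (Q - F) - Q * (Q - F) + (K - Q) * R) + (R - R * R)
        evaluate = solve-∀

    -- ⌊t/2⌋ < k ≤ t: the slope −1 range [t − n, t − k) and the slope −2 range [t − k, ⌊t/2⌋].
    partII-k≤t : n ≤ m → k ≤ n → t ≤ n ℕ.+ k → H < k → k ≤ t →
      + ∑ (suc (m ℕ.+ n ℕ.+ k)) (slice m n k t) ≡ coeff23′ (+ k) (+ H) (+ F) (+ r)
    partII-k≤t n≤m k≤n t≤n+k H<k k≤t =
      trans (half-+-double _ Pₖ Qₖ (twice-∑-slices-k≤t n≤m k≤n t≤n+k H<k k≤t)
              (even-≡ (as-Pₖ (+ H) (+ F) (+ k)) (even-diff₃ (+ H - + F + + 1) (+ H) (+ k - + 1))))
        (trans (regroup (half Pₖ) (+ H * + k) (+ k * (+ H - + F)) (+ H * (+ H - + F)) ((+ k - + H) * + r))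
          (sym (coeff23′-J≤L (+ k) (+ H) (+ F) (+ r) (J≮0 H<k) (≤ᵇ-by J (+ H - + F) ((t ℕ.∸ k) ℕ.∸ F) H-F≡))))
      where
      open ≡-Reasoning
      as-Pₖ : ∀ Q F K → (Q - F + + 1) * ((Q - F + + 1) + + 1) - Q * (Q + + 1) - (K - + 1) * ((K - + 1) + + 1)
                      ≡ (Q - F + + 1) * (Q - F + + 2) - Q * (Q + + 1) - K * (K - + 1)
      as-Pₖ = solve-∀
      regroup : ∀ h A B C D → h + (A + B - C + D) ≡ h + A + B - C + D
      regroup = solve-∀
      simplify : ∀ K Q R F → K - Q - R + (((R + Q * + 2) - K) - F) ≡ Q - F
      simplify = solve-∀
      H-F≡ : + H - + F ≡ J + + ((t ℕ.∸ k) ℕ.∸ F)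
      H-F≡ = sym (begin
        J + + ((t ℕ.∸ k) ℕ.∸ F)                  ≡⟨ cong (λ u → J + u) (trans (pos-∸ (F≤t∸k k≤n)) (cong (_- + F) (pos-∸ k≤t))) ⟩
        J + ((+ t - + k) - + F)                  ≡⟨ cong (λ v → J + ((v - + k) - + F)) (pos-t P) ⟩
        J + (((+ r + + H * + 2) - + k) - + F)     ≡⟨ simplify (+ k) (+ H) (+ r) (+ F) ⟩
        + H - + F                                ∎)

  partII-slices : ∀ m n k t → n ≤ m → k ≤ n → t ≤ n ℕ.+ k →
    + ∑ (suc (m ℕ.+ n ℕ.+ k)) (slice m n k t) ≡ coeff23 k n (+ t)
  partII-slices m n k t n≤m k≤n t≤n+k =
    trans by-cases (sym (coeff23≡coeff23′ k n (+ t) (+ (H ℕ.⊓ k)) (+ (t ℕ.∸ n)) r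
      (cong (_⊓ + k) fl2≡) (pos-∸-⊔ t n) (ℤP.+-injective md2≡)))
    where
    P = halfDecomposition t
    open HalfDecomposition P renaming (quot to H; rem to r)
    by-cases : + ∑ (suc (m ℕ.+ n ℕ.+ k)) (slice m n k t) ≡ coeff23′ (+ k) (+ (H ℕ.⊓ k)) (+ (t ℕ.∸ n)) (+ r)
    by-cases with k ℕ.≤? H | t ℕ.<? k
    ... | yes k≤H | _ rewrite ℕP.m≥n⇒m⊓n≡n k≤H =
      partII-k≤quot m n k t r rem≤1 n≤m k≤n t≤n+k (≤-trans (ℕP.+-mono-≤ k≤H k≤H) (quot+quot≤t P))
    ... | no k≰H | yes t<k rewrite ℕP.m≤n⇒m⊓n≡m (ℕP.<⇒≤ (ℕP.≰⇒> k≰H)) = partII-t<k m n k t P n≤m k≤n t<k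
    ... | no k≰H | no t≮k rewrite ℕP.m≤n⇒m⊓n≡m (ℕP.<⇒≤ (ℕP.≰⇒> k≰H)) =
      partII-k≤t m n k t P n≤m k≤n t≤n+k (ℕP.≰⇒> k≰H) (ℕP.≮⇒≥ t≮k)


module PartIV where

  open import Data.Nat as ℕ using (ℕ; suc; z≤n; _≤_; _<_)
  open import Data.Nat.Properties as ℕP using (≤-trans; ≤-refl; m≤m+n; m≤n+m; +-comm)
  open import Data.Integer as ℤ using (ℤ; +_; _+_; _-_; _*_; -_; _⊓_; _⊔_)
  import Data.Integer.Properties as ℤP
  open import Data.Bool using (T; if_then_else_)
  open import Data.Empty using (⊥-elim)
  open import Data.Product using (_,_)
  open import Relation.Nullary using (¬_; yes; no)
  open import Relation.Binary.PropositionalEquality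
  open import Data.Integer.Tactic.RingSolver
  import Data.Nat.Tactic.RingSolver as ℕ-Solver
  open import Defs
  open FiniteSums
  open Slices
  open ArithmeticSums
  open SliceRegions
  open IntegerFacts

  S₁′ : ℤ → ℤ → ℤ → ℤ → ℤ
  S₁′ u t F₂ F₁ =
    if (t - u) <ᶻ + 0
    then (t - F₂) * (F₂ + + 1)
    else half ((t - u) * (t - u + + 1) + F₁ * (F₁ - + 1)
               - + 2 * F₂ * (F₂ + + 1) + + 2 * u * (t - u - F₁ + + 1)
               + + 2 * t * (F₂ - t + u))

  S₂′ : ℤ → ℤ → ℤ → ℤ → ℤ
  S₂′ v t F₂ F₁ =
    if (t - v) <ᶻ + 0
    then + 0
    else if (t - v) ≤ᶻ F₂
    then (t - v) * (t - v - F₁ + + 1) - half ((t - v) * (t - v + + 1) - F₁ * (F₁ - + 1))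
    else (t - v) * (F₂ - F₁ + + 1) - half (F₂ * (F₂ + + 1) - F₁ * (F₁ - + 1))

  coeff45≡ : ∀ m n k u v t F₂ F₁ → fl2 t ⊓ + v ≡ F₂ → + 0 ⊔ (t - ((+ m + + k) ⊓ + n)) ≡ F₁ →
    coeff45 m n k u v t ≡ S₁′ (+ u) t F₂ F₁ - S₂′ (+ v) t F₂ F₁ + F₂ - F₁ + + 1
  coeff45≡ m n k u v t F₂ F₁ refl refl = refl

  diff-≤ᶻ : ∀ t k Z → k ≤ t → t ℕ.∸ k ≤ Z → T ((+ t - + k) ≤ᶻ + Z)
  diff-≤ᶻ t k Z k≤t t∸k≤Z = ≤ᵇ-by (+ t - + k) (+ Z) (Z ℕ.∸ (t ℕ.∸ k))
    (sym (trans (cong (λ u → + t - + k + u) (trans (pos-∸ t∸k≤Z) (cong (λ u → + Z - u) (pos-∸ k≤t)))) (cancel (+ t) (+ k) (+ Z))))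
    where
    cancel : ∀ T K Z → T - K + (Z - (T - K)) ≡ Z
    cancel = solve-∀

  diff-≰ᶻ : ∀ t k Z → suc (k ℕ.+ Z) ≤ t → ¬ T ((+ t - + k) ≤ᶻ + Z)
  diff-≰ᶻ t k Z k+Z<t = ≰ᵇ-by (+ t - + k) (+ Z) (t ℕ.∸ suc (k ℕ.+ Z))
    (sym (trans (cong (λ u → + Z + (+ 1 + u)) (pos-∸ k+Z<t)) (cancel (+ t) (+ k) (+ Z))))
    where
    cancel : ∀ T K Z → Z + (+ 1 + (T - (+ 1 + (K + Z)))) ≡ T - K
    cancel = solve-∀

  halve-S₁-S₂ : ∀ S P₁ X P₂ Z F → + 2 * S ≡ P₁ - (+ 2 * X - P₂) + + 2 * Z - + 2 * F + + 2 → Even P₁ → Even P₂ →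
    S ≡ half P₁ - (X - half P₂) + Z - F + + 1
  halve-S₁-S₂ S P₁ X P₂ Z F e even₁ even₂ = ℤP.*-cancelˡ-≡ (+ 2) S _
    (trans e (trans (cong₂ (λ v u → v - (+ 2 * X - u) + + 2 * Z - + 2 * F + + 2) (sym (double-half P₁ even₁)) (sym (double-half P₂ even₂)))
                    (distrib (half P₁) X (half P₂) Z F)))
    where
    distrib : ∀ A X h Z F → + 2 * A - (+ 2 * X - + 2 * h) + + 2 * Z - + 2 * F + + 2 ≡ + 2 * (A - (X - h) + Z - F + + 1)
    distrib = solve-∀

  even-S₁ : ∀ T M Z F → Even ((T - M) * (T - M + + 1) + F * (F - + 1) - + 2 * Z * (Z + + 1) + + 2 * M * (T - M - F + + 1) + + 2 * T * (Z - T + M))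
  even-S₁ T M Z F = even-≡ (regroup T M Z F) (even-+ (even-+ (even-consecutive (T - M)) (even-consecutive (F - + 1))) (even-double _))
    where
    regroup : ∀ T M Z F → ((T - M) * ((T - M) + + 1) + (F - + 1) * ((F - + 1) + + 1)) + + 2 * (- (Z * (Z + + 1)) + M * (T - M - F + + 1) + T * (Z - T + M))
      ≡ (T - M) * (T - M + + 1) + F * (F - + 1) - + 2 * Z * (Z + + 1) + + 2 * M * (T - M - F + + 1) + + 2 * T * (Z - T + M)
    regroup = solve-∀

  even-S₂ : ∀ A F → Even (A * (A + + 1) - F * (F - + 1))
  even-S₂ A F = even-≡ (regroup A F) (even-+ (even-consecutive A) (even-neg (even-consecutive (F - + 1))))
    where
    regroup : ∀ A F → A * (A + + 1) - (F - + 1) * ((F - + 1) + + 1) ≡ A * (A + + 1) - F * (F - + 1)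
    regroup = solve-∀

  S₁′-t<u : ∀ u t F₂ F₁ → t < u → S₁′ (+ u) (+ t) F₂ F₁ ≡ (+ t - F₂) * (F₂ + + 1)
  S₁′-t<u u t F₂ F₁ t<u = if-T (<ᶻ0-by t u t<u)

  S₁′-u≤t : ∀ u t F₂ F₁ → u ≤ t → S₁′ (+ u) (+ t) F₂ F₁ ≡
    half ((+ t - + u) * (+ t - + u + + 1) + F₁ * (F₁ - + 1) - + 2 * F₂ * (F₂ + + 1)
          + + 2 * + u * (+ t - + u - F₁ + + 1) + + 2 * + t * (F₂ - + t + + u))
  S₁′-u≤t u t F₂ F₁ u≤t = if-¬T (≮ᶻ0-by t u u≤t)

  S₂′-t<v : ∀ v t F₂ F₁ → t < v → S₂′ (+ v) (+ t) F₂ F₁ ≡ + 0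
  S₂′-t<v v t F₂ F₁ t<v = if-T (<ᶻ0-by t v t<v)

  S₂′-t∸v≤F₂ : ∀ v t F₂ F₁ → v ≤ t → t ℕ.∸ v ≤ F₂ → S₂′ (+ v) (+ t) (+ F₂) F₁ ≡
    (+ t - + v) * (+ t - + v - F₁ + + 1) - half ((+ t - + v) * (+ t - + v + + 1) - F₁ * (F₁ - + 1))
  S₂′-t∸v≤F₂ v t F₂ F₁ v≤t t∸v≤F₂ = trans (if-¬T (≮ᶻ0-by t v v≤t)) (if-T (diff-≤ᶻ t v F₂ v≤t t∸v≤F₂))

  S₂′-F₂<t∸v : ∀ v t F₂ F₁ → suc (v ℕ.+ F₂) ≤ t → S₂′ (+ v) (+ t) (+ F₂) F₁ ≡
    (+ t - + v) * (+ F₂ - F₁ + + 1) - half (+ F₂ * (+ F₂ + + 1) - F₁ * (F₁ - + 1))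
  S₂′-F₂<t∸v v t F₂ F₁ v+F₂<t =
    trans (if-¬T (≮ᶻ0-by t v (≤-trans (m≤m+n v F₂) (ℕP.<⇒≤ v+F₂<t)))) (if-¬T (diff-≰ᶻ t v F₂ v+F₂<t))

  module _ (m n k t : ℕ) (P : HalfDecomposition t) (k≤m : k ≤ m) (m≤n : m ≤ n) (t≤m+k : t ≤ m ℕ.+ k) where
    open HalfDecomposition P renaming (quot to H; rem to r)

    private
      Z = H ℕ.⊓ k
      F = t ℕ.∸ n
      Z≤k : Z ≤ k
      Z≤k = ℕP.m⊓n≤n H k
      Z≤H : Z ≤ H
      Z≤H = ℕP.m⊓n≤m H k
      beyond-Z : ∀ z → Z < z → z ℕ.+ z ≤ t → z ≤ m → k < z
      beyond-Z z Z<z zz≤t _ with z ℕ.≤? k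
      ... | no z≰k = ℕP.≰⇒> z≰k
      ... | yes z≤k = ⊥-elim (ℕP.<⇒≱ Z<z (ℕP.⊓-glb (quot-maximal P z zz≤t) z≤k))

      segments : ℤ → ℤ → ℤ → ℤ
      segments F₁ C₁ C₂ = twiceArithSum (C₁ - F₁) (+ m + + k - + t + + 1) (+ 0) F₁
        + (twiceArithSum (C₂ - C₁) (+ k + + 1) (- + 1) C₁ + twiceArithSum (+ 1 + + Z - C₂) (+ t + + 1) (- + 2) C₂)

      -- The flat range ends at t − m: below it the binding upper bound on x is m − z.
      twice-∑-slices-IV : ∀ c₂ → t ℕ.∸ m ≤ c₂ → c₂ ≤ suc Z →
        (∀ z → t ℕ.∸ m ≤ z → z < c₂ → z ℕ.+ k ≤ t) → (∀ z → c₂ ≤ z → z ≤ Z → t ≤ z ℕ.+ k) →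
        + 2 * + ∑ (suc (m ℕ.+ n ℕ.+ k)) (slice m n k t) ≡ segments (+ F) (+ (t ℕ.∸ m)) (+ c₂)
      twice-∑-slices-IV c₂ t∸m≤c₂ c₂≤1+Z range₂ range₃ =
        twice-∑-slices m n k t (t ℕ.∸ m) c₂ Z (ℕP.∸-monoʳ-≤ t m≤n) t∸m≤c₂ c₂≤1+Z
          (≤-trans (ℕP.+-mono-≤ Z≤H Z≤H) (quot+quot≤t P)) (≤-trans Z≤k k≤m) Z≤k beyond-Z t≤m+k (ℕP.m≤n+m∸n t m)
          (λ z _ z<t∸m → let z+m≤t = z+m≤t z<t∸m in z+m≤t , ≤-trans (ℕP.+-monoʳ-≤ z k≤m) z+m≤t)
          range₂ range₃
        where
        z+m≤t : ∀ {z} → z < t ℕ.∸ m → z ℕ.+ m ≤ t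
        z+m≤t {z} z<t∸m = ℕP.m≤o∸n⇒m+n≤o z (ℕP.<⇒≤ (ℕP.m∸n≢0⇒n<m (λ t∸m≡0 → ℕP.<⇒≱ z<t∸m (subst (_≤ z) (sym t∸m≡0) z≤n))))
                            (ℕP.<⇒≤ z<t∸m)

      -- S₁ = P₁ / 2 when t ≥ m.
      P₁ : ℤ
      P₁ = (+ t - + m) * (+ t - + m + + 1) + + F * (+ F - + 1) - + 2 * + Z * (+ Z + + 1)
           + + 2 * + m * (+ t - + m - + F + + 1) + + 2 * + t * (+ Z - + t + + m)

      target : ℤ
      target = S₁′ (+ m) (+ t) (+ Z) (+ F) - S₂′ (+ k) (+ t) (+ Z) (+ F) + + Z - + F + + 1

      halve-S₂ : ∀ S A X P₂ Z F → + 2 * S ≡ + 2 * A - (+ 2 * X - P₂) + + 2 * Z - + 2 * F + + 2 → Even P₂ →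
        S ≡ A - (X - half P₂) + Z - F + + 1
      halve-S₂ S A X P₂ Z F e even₂ =
        trans (halve-S₁-S₂ S (+ 2 * A) X P₂ Z F e (even-double A) even₂)
              (cong (λ h → h - (X - half P₂) + Z - F + + 1) (half-double A))

      t<m⇒t∸m≡0 : t < m → t ℕ.∸ m ≡ 0
      t<m⇒t∸m≡0 t<m = ℕP.m≤n⇒m∸n≡0 (ℕP.<⇒≤ t<m)

      t<m⇒F≡0 : t < m → F ≡ 0
      t<m⇒F≡0 t<m = ℕP.m≤n⇒m∸n≡0 (≤-trans (ℕP.<⇒≤ t<m) m≤n)

      target-F≡0 : t < m → target ≡ S₁′ (+ m) (+ t) (+ Z) (+ 0) - S₂′ (+ k) (+ t) (+ Z) (+ 0) + + Z - + 0 + + 1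
      target-F≡0 t<m = cong (λ f → S₁′ (+ m) (+ t) (+ Z) (+ f) - S₂′ (+ k) (+ t) (+ Z) (+ f) + + Z - + f + + 1) (t<m⇒F≡0 t<m)

      partIV-t<k : t < k → + ∑ (suc (m ℕ.+ n ℕ.+ k)) (slice m n k t) ≡ target
      partIV-t<k t<k = ℤP.*-cancelˡ-≡ (+ 2) _ _ (begin
        + 2 * + ∑ (suc (m ℕ.+ n ℕ.+ k)) (slice m n k t)
          ≡⟨ twice-∑-slices-IV 0 (subst (_≤ 0) (sym (t<m⇒t∸m≡0 t<m)) z≤n) z≤n (λ z _ ())
               (λ z _ _ → ≤-trans (ℕP.<⇒≤ t<k) (m≤n+m k z)) ⟩
        segments (+ F) (+ (t ℕ.∸ m)) (+ 0)
          ≡⟨ cong₂ (λ f c → segments (+ f) (+ c) (+ 0)) (t<m⇒F≡0 t<m) (t<m⇒t∸m≡0 t<m) ⟩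
        segments (+ 0) (+ 0) (+ 0)
          ≡⟨ evaluate (+ m) (+ k) (+ t) (+ Z) ⟩
        + 2 * ((+ t - + Z) * (+ Z + + 1) - + 0 + + Z - + 0 + + 1)
          ≡⟨ cong (+ 2 *_) (sym (trans (target-F≡0 t<m)
               (cong₂ (λ a b → a - b + + Z - + 0 + + 1) (S₁′-t<u m t (+ Z) (+ 0) t<m) (S₂′-t<v k t (+ Z) (+ 0) t<k)))) ⟩
        + 2 * target ∎)
        where
        open ≡-Reasoning
        t<m : t < m
        t<m = ℕP.<-≤-trans t<k k≤m
        evaluate : ∀ M K T Z → let seg = λ l A B c → + 2 * l * A + B * (l * (+ 2 * c + l - + 1)) in
          seg (+ 0 - + 0) (M + K - T + + 1) (+ 0) (+ 0)
            + (seg (+ 0 - + 0) (K + + 1) (- + 1) (+ 0) + seg (+ 1 + Z - + 0) (T + + 1) (- + 2) (+ 0))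
          ≡ + 2 * ((T - Z) * (Z + + 1) - + 0 + Z - + 0 + + 1)
        evaluate = solve-∀

      t∸k-range₂ : k ≤ t → ∀ z → t ℕ.∸ m ≤ z → z < t ℕ.∸ k → z ℕ.+ k ≤ t
      t∸k-range₂ k≤t z _ z<t∸k = ≤-trans (ℕP.+-monoˡ-≤ k (ℕP.<⇒≤ z<t∸k)) (ℕP.≤-reflexive (ℕP.m∸n+n≡m k≤t))

      t∸k-range₃ : k ≤ t → ∀ z → t ℕ.∸ k ≤ z → z ≤ Z → t ≤ z ℕ.+ k
      t∸k-range₃ k≤t z t∸k≤z _ = ≤-trans (ℕP.≤-reflexive (sym (ℕP.m∸n+n≡m k≤t))) (ℕP.+-monoˡ-≤ k t∸k≤z)

      k+Z<t-range₂ : suc (k ℕ.+ Z) ≤ t → ∀ z → t ℕ.∸ m ≤ z → z < suc Z → z ℕ.+ k ≤ t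
      k+Z<t-range₂ k+Z<t z _ z≤Z = ≤-trans (ℕP.+-monoˡ-≤ k (ℕP.≤-pred z≤Z)) (≤-trans (ℕP.≤-reflexive (+-comm Z k)) (ℕP.<⇒≤ k+Z<t))

      no-range₃ : ∀ z → suc Z ≤ z → z ≤ Z → t ≤ z ℕ.+ k
      no-range₃ z 1+Z≤z z≤Z = ⊥-elim (ℕP.<⇒≱ 1+Z≤z z≤Z)

      partIV-t<m-t∸k≤Z : k ≤ t → t < m → t ℕ.∸ k ≤ Z → + ∑ (suc (m ℕ.+ n ℕ.+ k)) (slice m n k t) ≡ target
      partIV-t<m-t∸k≤Z k≤t t<m t∸k≤Z =
        trans (halve-S₂ _ A X P₂ (+ Z) (+ 0) twice≡ (even-S₂ (+ t - + k) (+ 0)))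
          (sym (trans (target-F≡0 t<m)
            (cong₂ (λ a b → a - b + + Z - + 0 + + 1) (S₁′-t<u m t (+ Z) (+ 0) t<m) (S₂′-t∸v≤F₂ k t Z (+ 0) k≤t t∸k≤Z))))
        where
        open ≡-Reasoning
        A = (+ t - + Z) * (+ Z + + 1)
        X = (+ t - + k) * (+ t - + k - + 0 + + 1)
        P₂ = (+ t - + k) * (+ t - + k + + 1) - + 0 * (+ 0 - + 1)
        evaluate : ∀ M K T Z → let seg = λ l A B c → + 2 * l * A + B * (l * (+ 2 * c + l - + 1)) in
          seg (+ 0 - + 0) (M + K - T + + 1) (+ 0) (+ 0)
            + (seg ((T - K) - + 0) (K + + 1) (- + 1) (+ 0) + seg (+ 1 + Z - (T - K)) (T + + 1) (- + 2) (T - K))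
          ≡ + 2 * ((T - Z) * (Z + + 1)) - (+ 2 * ((T - K) * (T - K - + 0 + + 1)) - ((T - K) * (T - K + + 1) - + 0 * (+ 0 - + 1)))
            + + 2 * Z - + 2 * + 0 + + 2
        evaluate = solve-∀
        twice≡ : + 2 * + ∑ (suc (m ℕ.+ n ℕ.+ k)) (slice m n k t) ≡ + 2 * A - (+ 2 * X - P₂) + + 2 * + Z - + 2 * + 0 + + 2
        twice≡ = begin
          + 2 * + ∑ (suc (m ℕ.+ n ℕ.+ k)) (slice m n k t)
            ≡⟨ twice-∑-slices-IV (t ℕ.∸ k) (ℕP.∸-monoʳ-≤ t k≤m) (ℕP.m≤n⇒m≤1+n t∸k≤Z) (t∸k-range₂ k≤t) (t∸k-range₃ k≤t) ⟩
          segments (+ F) (+ (t ℕ.∸ m)) (+ (t ℕ.∸ k))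
            ≡⟨ cong₃ segments (cong +_ (t<m⇒F≡0 t<m)) (cong +_ (t<m⇒t∸m≡0 t<m)) (pos-∸ k≤t) ⟩
          segments (+ 0) (+ 0) (+ t - + k)
            ≡⟨ evaluate (+ m) (+ k) (+ t) (+ Z) ⟩
          _ ∎

      partIV-m≤t-t∸k≤Z : m ≤ t → t ℕ.∸ k ≤ Z → + ∑ (suc (m ℕ.+ n ℕ.+ k)) (slice m n k t) ≡ target
      partIV-m≤t-t∸k≤Z m≤t t∸k≤Z =
        trans (halve-S₁-S₂ _ P₁ X P₂ (+ Z) (+ F) twice≡ (even-S₁ (+ t) (+ m) (+ Z) (+ F)) (even-S₂ (+ t - + k) (+ F)))
          (sym (cong₂ (λ a b → a - b + + Z - + F + + 1) (S₁′-u≤t m t (+ Z) (+ F) m≤t) (S₂′-t∸v≤F₂ k t Z (+ F) k≤t t∸k≤Z)))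
        where
        open ≡-Reasoning
        k≤t : k ≤ t
        k≤t = ≤-trans k≤m m≤t
        X = (+ t - + k) * (+ t - + k - + F + + 1)
        P₂ = (+ t - + k) * (+ t - + k + + 1) - + F * (+ F - + 1)
        evaluate : ∀ M K T Z F → let seg = λ l A B c → + 2 * l * A + B * (l * (+ 2 * c + l - + 1)) in
          seg ((T - M) - F) (M + K - T + + 1) (+ 0) F
            + (seg ((T - K) - (T - M)) (K + + 1) (- + 1) (T - M) + seg (+ 1 + Z - (T - K)) (T + + 1) (- + 2) (T - K))
          ≡ ((T - M) * (T - M + + 1) + F * (F - + 1) - + 2 * Z * (Z + + 1) + + 2 * M * (T - M - F + + 1) + + 2 * T * (Z - T + M))
            - (+ 2 * ((T - K) * (T - K - F + + 1)) - ((T - K) * (T - K + + 1) - F * (F - + 1))) + + 2 * Z - + 2 * F + + 2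
        evaluate = solve-∀
        twice≡ : + 2 * + ∑ (suc (m ℕ.+ n ℕ.+ k)) (slice m n k t) ≡ P₁ - (+ 2 * X - P₂) + + 2 * + Z - + 2 * + F + + 2
        twice≡ = begin
          + 2 * + ∑ (suc (m ℕ.+ n ℕ.+ k)) (slice m n k t)
            ≡⟨ twice-∑-slices-IV (t ℕ.∸ k) (ℕP.∸-monoʳ-≤ t k≤m) (ℕP.m≤n⇒m≤1+n t∸k≤Z) (t∸k-range₂ k≤t) (t∸k-range₃ k≤t) ⟩
          segments (+ F) (+ (t ℕ.∸ m)) (+ (t ℕ.∸ k))
            ≡⟨ cong₂ (segments (+ F)) (pos-∸ m≤t) (pos-∸ k≤t) ⟩
          segments (+ F) (+ t - + m) (+ t - + k)
            ≡⟨ evaluate (+ m) (+ k) (+ t) (+ Z) (+ F) ⟩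
          _ ∎

      partIV-t<m-Z<t∸k : t < m → suc (k ℕ.+ Z) ≤ t → + ∑ (suc (m ℕ.+ n ℕ.+ k)) (slice m n k t) ≡ target
      partIV-t<m-Z<t∸k t<m k+Z<t =
        trans (halve-S₂ _ A X P₂ (+ Z) (+ 0) twice≡ (even-S₂ (+ Z) (+ 0)))
          (sym (trans (target-F≡0 t<m)
            (cong₂ (λ a b → a - b + + Z - + 0 + + 1) (S₁′-t<u m t (+ Z) (+ 0) t<m) (S₂′-F₂<t∸v k t Z (+ 0) k+Z<t))))
        where
        open ≡-Reasoning
        A = (+ t - + Z) * (+ Z + + 1)
        X = (+ t - + k) * (+ Z - + 0 + + 1)
        P₂ = + Z * (+ Z + + 1) - + 0 * (+ 0 - + 1)
        evaluate : ∀ M K T Z → let seg = λ l A B c → + 2 * l * A + B * (l * (+ 2 * c + l - + 1)) in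
          seg (+ 0 - + 0) (M + K - T + + 1) (+ 0) (+ 0)
            + (seg ((+ 1 + Z) - + 0) (K + + 1) (- + 1) (+ 0) + seg (+ 1 + Z - (+ 1 + Z)) (T + + 1) (- + 2) (+ 1 + Z))
          ≡ + 2 * ((T - Z) * (Z + + 1)) - (+ 2 * ((T - K) * (Z - + 0 + + 1)) - (Z * (Z + + 1) - + 0 * (+ 0 - + 1)))
            + + 2 * Z - + 2 * + 0 + + 2
        evaluate = solve-∀
        twice≡ : + 2 * + ∑ (suc (m ℕ.+ n ℕ.+ k)) (slice m n k t) ≡ + 2 * A - (+ 2 * X - P₂) + + 2 * + Z - + 2 * + 0 + + 2
        twice≡ = begin
          + 2 * + ∑ (suc (m ℕ.+ n ℕ.+ k)) (slice m n k t)
            ≡⟨ twice-∑-slices-IV (suc Z) (subst (_≤ suc Z) (sym (t<m⇒t∸m≡0 t<m)) z≤n) ≤-refl (k+Z<t-range₂ k+Z<t) no-range₃ ⟩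
          segments (+ F) (+ (t ℕ.∸ m)) (+ suc Z)
            ≡⟨ cong₂ (λ f c → segments (+ f) (+ c) (+ suc Z)) (t<m⇒F≡0 t<m) (t<m⇒t∸m≡0 t<m) ⟩
          segments (+ 0) (+ 0) (+ 1 + + Z)
            ≡⟨ evaluate (+ m) (+ k) (+ t) (+ Z) ⟩
          _ ∎

      partIV-m≤t-Z<t∸k : m ≤ t → suc (k ℕ.+ Z) ≤ t → t ℕ.∸ m ≤ Z → + ∑ (suc (m ℕ.+ n ℕ.+ k)) (slice m n k t) ≡ target
      partIV-m≤t-Z<t∸k m≤t k+Z<t t∸m≤Z =
        trans (halve-S₁-S₂ _ P₁ X P₂ (+ Z) (+ F) twice≡ (even-S₁ (+ t) (+ m) (+ Z) (+ F)) (even-S₂ (+ Z) (+ F)))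
          (sym (cong₂ (λ a b → a - b + + Z - + F + + 1) (S₁′-u≤t m t (+ Z) (+ F) m≤t) (S₂′-F₂<t∸v k t Z (+ F) k+Z<t)))
        where
        open ≡-Reasoning
        X = (+ t - + k) * (+ Z - + F + + 1)
        P₂ = + Z * (+ Z + + 1) - + F * (+ F - + 1)
        evaluate : ∀ M K T Z F → let seg = λ l A B c → + 2 * l * A + B * (l * (+ 2 * c + l - + 1)) in
          seg ((T - M) - F) (M + K - T + + 1) (+ 0) F
            + (seg ((+ 1 + Z) - (T - M)) (K + + 1) (- + 1) (T - M) + seg (+ 1 + Z - (+ 1 + Z)) (T + + 1) (- + 2) (+ 1 + Z))
          ≡ ((T - M) * (T - M + + 1) + F * (F - + 1) - + 2 * Z * (Z + + 1) + + 2 * M * (T - M - F + + 1) + + 2 * T * (Z - T + M))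
            - (+ 2 * ((T - K) * (Z - F + + 1)) - (Z * (Z + + 1) - F * (F - + 1))) + + 2 * Z - + 2 * F + + 2
        evaluate = solve-∀
        twice≡ : + 2 * + ∑ (suc (m ℕ.+ n ℕ.+ k)) (slice m n k t) ≡ P₁ - (+ 2 * X - P₂) + + 2 * + Z - + 2 * + F + + 2
        twice≡ = begin
          + 2 * + ∑ (suc (m ℕ.+ n ℕ.+ k)) (slice m n k t)
            ≡⟨ twice-∑-slices-IV (suc Z) (ℕP.m≤n⇒m≤1+n t∸m≤Z) ≤-refl (k+Z<t-range₂ k+Z<t) no-range₃ ⟩
          segments (+ F) (+ (t ℕ.∸ m)) (+ suc Z)
            ≡⟨ cong (λ c → segments (+ F) c (+ suc Z)) (pos-∸ m≤t) ⟩
          segments (+ F) (+ t - + m) (+ 1 + + Z)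
            ≡⟨ evaluate (+ m) (+ k) (+ t) (+ Z) (+ F) ⟩
          _ ∎

      k+Z<t : k ≤ t → ¬ (t ℕ.∸ k ≤ Z) → suc (k ℕ.+ Z) ≤ t
      k+Z<t k≤t t∸k≰Z = subst (_≤ t) (cong suc (+-comm Z k))
        (subst (suc Z ℕ.+ k ≤_) (ℕP.m∸n+n≡m k≤t) (ℕP.+-monoˡ-≤ k (ℕP.≰⇒> t∸k≰Z)))

      t∸m≤Z : t ℕ.∸ m ≤ Z
      t∸m≤Z = ℕP.⊓-glb (ℕP.m≤n+o⇒m∸n≤o t m t≤m+H) (ℕP.m≤n+o⇒m∸n≤o t m t≤m+k)
        where
        H+r≤m : H ℕ.+ r ≤ m
        H+r≤m = quot+rem≤ P m (≤-trans t≤m+k (ℕP.+-monoʳ-≤ m k≤m))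
        t≤m+H : t ≤ m ℕ.+ H
        t≤m+H = subst (_≤ m ℕ.+ H) (trans (regroup H r) (sym t≡)) (ℕP.+-monoˡ-≤ H H+r≤m)
          where
          regroup : ∀ q ρ → q ℕ.+ ρ ℕ.+ q ≡ ρ ℕ.+ q ℕ.* 2
          regroup = ℕ-Solver.solve-∀

    partIV-by-cases : + ∑ (suc (m ℕ.+ n ℕ.+ k)) (slice m n k t) ≡
      S₁′ (+ m) (+ t) (+ (H ℕ.⊓ k)) (+ (t ℕ.∸ n)) - S₂′ (+ k) (+ t) (+ (H ℕ.⊓ k)) (+ (t ℕ.∸ n)) + + (H ℕ.⊓ k) - + (t ℕ.∸ n) + + 1
    partIV-by-cases with t ℕ.<? k
    ... | yes t<k = partIV-t<k t<k
    ... | no t≮k with ℕP.≮⇒≥ t≮k | t ℕ.∸ k ℕ.≤? Z | t ℕ.<? m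
    ...   | k≤t | yes t∸k≤Z | yes t<m = partIV-t<m-t∸k≤Z k≤t t<m t∸k≤Z
    ...   | k≤t | yes t∸k≤Z | no t≮m = partIV-m≤t-t∸k≤Z (ℕP.≮⇒≥ t≮m) t∸k≤Z
    ...   | k≤t | no t∸k≰Z | yes t<m = partIV-t<m-Z<t∸k t<m (k+Z<t k≤t t∸k≰Z)
    ...   | k≤t | no t∸k≰Z | no t≮m = partIV-m≤t-Z<t∸k (ℕP.≮⇒≥ t≮m) (k+Z<t k≤t t∸k≰Z) t∸m≤Z

  partIV-slices : ∀ m n k t → m ≤ n → k ≤ m → t ≤ m ℕ.+ k →
    + ∑ (suc (m ℕ.+ n ℕ.+ k)) (slice m n k t) ≡ coeff45 m n k m k (+ t)
  partIV-slices m n k t m≤n k≤m t≤m+k =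
    trans (partIV-by-cases m n k t P k≤m m≤n t≤m+k)
          (sym (coeff45≡ m n k m k (+ t) (+ (H ℕ.⊓ k)) (+ (t ℕ.∸ n)) (cong (_⊓ + k) fl2≡) F₁≡))
    where
    P = halfDecomposition t
    open HalfDecomposition P renaming (quot to H)
    F₁≡ : + 0 ⊔ (+ t - ((+ m + + k) ⊓ + n)) ≡ + (t ℕ.∸ n)
    F₁≡ with n ℕ.≤? m ℕ.+ k
    ... | yes n≤m+k = trans (cong (λ u → + 0 ⊔ (+ t - + u)) (ℕP.m≥n⇒m⊓n≡n n≤m+k))
                            (trans (ℤP.⊔-comm (+ 0) (+ t - + n)) (pos-∸-⊔ t n))
    ... | no n≰m+k = trans (cong (λ u → + 0 ⊔ (+ t - + u)) (ℕP.m≤n⇒m⊓n≡m (ℕP.<⇒≤ m+k<n)))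
                           (trans (trans (ℤP.⊔-comm (+ 0) (+ t - + (m ℕ.+ k))) (pos-∸-⊔ t (m ℕ.+ k)))
                                  (cong +_ (trans (ℕP.m≤n⇒m∸n≡0 t≤m+k) (sym (ℕP.m≤n⇒m∸n≡0 (≤-trans t≤m+k (ℕP.<⇒≤ m+k<n)))))))
      where m+k<n = ℕP.≰⇒> n≰m+k


open import Data.Nat as ℕ using (ℕ; suc; s≤s; _≤_; _<_; _≥_; _+_; _∸_)
open import Data.Nat.Properties as ℕP using (≤-trans; m≤m+n; +-comm; +-assoc)
open import Data.Integer as ℤ using (ℤ; +_)
open import Data.Bool using (T; _∧_; if_then_else_)
open import Data.Product using (_×_; _,_; proj₁; proj₂)
open import Data.Empty using (⊥-elim)
open import Relation.Nullary using (yes; no)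
open import Relation.Nullary.Decidable using (T?)
open import Relation.Binary.PropositionalEquality
import Data.Nat.Tactic.RingSolver as ℕ-Solver
open import Defs
open FiniteSums
open Slices
open Symmetry
open ArithmeticSums
open SliceRegions
open IntegerFacts
open PartI
open PartII
open PartIV

∑-slices-vanish : ∀ m n k t → (∀ z → T (admissible m n t z) → slice m n k t z ≡ 0) →
  ∑ (suc (m + n + k)) (slice m n k t) ≡ 0
∑-slices-vanish m n k t vanish = ∑-zero (suc (m + n + k)) λ z _ → helper z
  where
  helper : ∀ z → slice m n k t z ≡ 0
  helper z with T? (admissible m n t z)
  ... | yes adm = vanish z adm
  ... | no ¬adm = slice-inadmissible m n k t z ¬adm

∑-slices-2n<t : ∀ m n k t → n + n < t → ∑ (suc (m + n + k)) (slice m n k t) ≡ 0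
∑-slices-2n<t m n k t 2n<t = ∑-slices-vanish m n k t λ z adm →
  let zz≤t , _ , t≤n+z = admissible-elim {m} {n} {t} {z} adm in
  ⊥-elim (ℕP.<⇒≱ 2n<t (≤-trans t≤n+z (ℕP.+-monoʳ-≤ n (ℕP.+-cancelʳ-≤ z z n (≤-trans zz≤t t≤n+z)))))
∑-slices-n+k<t : ∀ m n k t → n + k < t → ∑ (suc (m + n + k)) (slice m n k t) ≡ 0
∑-slices-n+k<t m n k t n+k<t = ∑-slices-vanish m n k t λ z adm →
  let zz≤t , _ , t≤n+z = admissible-elim {m} {n} {t} {z} adm in
  slice-beyond-k m n k t z zz≤t (ℕP.+-cancelˡ-< n k z (ℕP.<-≤-trans n+k<t t≤n+z))

∑-slices-m+k<t : ∀ m n k t → m + k < t → ∑ (suc (m + n + k)) (slice m n k t) ≡ 0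
∑-slices-m+k<t m n k t m+k<t = ∑-slices-vanish m n k t λ z adm →
  let _ , z≤m , _ = admissible-elim {m} {n} {t} {z} adm in
  slice-empty m n k t z (ℕP.<-≤-trans (s≤s (ℕP.m⊓n≤m (m ∸ z) (t ∸ (z + z))))
    (ℕP.m+n≤o⇒m≤o∸n (suc (m ∸ z)) (ℕP.m+n≤o⇒m≤o∸n (suc (m ∸ z) + k) (subst (_≤ t) (sym (regroup z≤m)) m+k<t))))
  where
  regroup : ∀ {z} → z ≤ m → suc (m ∸ z) + k + z ≡ suc (m + k)
  regroup {z} z≤m = cong suc (trans (+-assoc (m ∸ z) k z) (trans (cong (λ u → (m ∸ z) + u) (+-comm k z))
    (trans (sym (+-assoc (m ∸ z) z k)) (cong (_+ k) (ℕP.m∸n+n≡m z≤m)))))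

kpfCoeff≡rangeCoeff : ∀ m n k lo (c : ℕ → ℤ) →
  (∀ i → i ≤ m + n + k → lo ≤ i → + ∑ (suc (m + n + k)) (slice m n k (m + n + k ∸ i)) ≡ c i) →
  (∀ i → i ≤ m + n + k → i < lo → ∑ (suc (m + n + k)) (slice m n k (m + n + k ∸ i)) ≡ 0) →
  ∀ i → + kpfCoeff m n k i ≡ rangeCoeff lo (m + n + k) c i
kpfCoeff≡rangeCoeff m n k lo c inside below i with i ℕ.≤? m + n + k | lo ℕ.≤? i
... | no i≰S | _ =
  trans (cong +_ (kpfCoeff-above m n k i (ℕP.≰⇒> i≰S))) (sym (if-¬T (λ h → i≰S (ℕP.≤ᵇ⇒≤ _ _ (proj₂ (T-∧-proj {lo ℕ.≤ᵇ i} h))))))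
... | yes i≤S | yes lo≤i =
  trans (cong +_ (kpfCoeff-slices m n k i i≤S)) (trans (inside i i≤S lo≤i) (sym (if-T (T-∧-intro (ℕP.≤⇒≤ᵇ lo≤i) (ℕP.≤⇒≤ᵇ i≤S)))))
... | yes i≤S | no lo≰i =
  trans (cong +_ (trans (kpfCoeff-slices m n k i i≤S) (below i i≤S (ℕP.≰⇒> lo≰i))))
        (sym (if-¬T (λ h → lo≰i (ℕP.≤ᵇ⇒≤ _ _ (proj₁ (T-∧-proj h))))))

∸-below : ∀ {S lo b i} → S ≡ lo + b → lo ≤ i → S ∸ i ≤ b
∸-below {S} {lo} {b} {i} S≡ lo≤i = ℕP.m≤n+o⇒m∸n≤o S i (subst (_≤ i + b) (sym S≡) (ℕP.+-monoˡ-≤ b lo≤i))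

∸-above : ∀ {S lo b i} → S ≡ lo + b → i < lo → b < S ∸ i
∸-above {S} {lo} {b} {i} S≡ i<lo = ℕP.+-cancelˡ-< i b (S ∸ i)
  (subst (i + b <_) (sym (ℕP.m+[n∸m]≡n (≤-trans (m≤m+n i b) (ℕP.<⇒≤ i+b<S)))) i+b<S)
  where
  i+b<S : i + b < S
  i+b<S = subst (i + b <_) (sym S≡) (ℕP.+-monoˡ-< b i<lo)

tOf≡ : ∀ m n k i → i ≤ m + n + k → tOf m n k i ≡ + (m + n + k ∸ i)
tOf≡ m n k i i≤S = sym (pos-∸ i≤S)

partI : ∀ m n k → m ≥ n → k ≥ n → ∀ i →
  + kpfCoeff m n k i ≡ rangeCoeff (m + k ∸ n) (m + n + k) (λ j → coeff1 n (tOf m n k j)) i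
partI m n k n≤m n≤k = kpfCoeff≡rangeCoeff m n k (m + k ∸ n) _
  (λ i i≤S lo≤i → trans (partI-slices m n k _ n≤m n≤k (∸-below S≡ lo≤i)) (cong (coeff1 n) (sym (tOf≡ m n k i i≤S))))
  (λ i _ i<lo → ∑-slices-2n<t m n k _ (∸-above S≡ i<lo))
  where
  S≡ : m + n + k ≡ (m + k ∸ n) + (n + n)
  S≡ = begin
    m + n + k              ≡⟨ regroup m n k ⟩
    (m + k) + n            ≡⟨ cong (_+ n) (sym (ℕP.m∸n+n≡m (≤-trans n≤m (m≤m+n m k)))) ⟩
    (m + k ∸ n) + n + n    ≡⟨ +-assoc (m + k ∸ n) n n ⟩
    (m + k ∸ n) + (n + n)  ∎
    where
    open ≡-Reasoning
    regroup : ∀ m n k → m + n + k ≡ (m + k) + n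
    regroup = ℕ-Solver.solve-∀

partII : ∀ m n k → m ≥ n → n ≥ k → ∀ i →
  + kpfCoeff m n k i ≡ rangeCoeff m (m + n + k) (λ j → coeff23 k n (tOf m n k j)) i
partII m n k n≤m k≤n = kpfCoeff≡rangeCoeff m n k m _
  (λ i i≤S m≤i → trans (partII-slices m n k _ n≤m k≤n (∸-below (+-assoc m n k) m≤i)) (cong (coeff23 k n) (sym (tOf≡ m n k i i≤S))))
  (λ i _ i<m → ∑-slices-n+k<t m n k _ (∸-above (+-assoc m n k) i<m))

partIV : ∀ m n k → n ≥ m → m ≥ k → ∀ i →
  + kpfCoeff m n k i ≡ rangeCoeff n (m + n + k) (λ j → coeff45 m n k m k (tOf m n k j)) i
partIV m n k m≤n k≤m = kpfCoeff≡rangeCoeff m n k n _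
  (λ i i≤S n≤i → trans (partIV-slices m n k _ m≤n k≤m (∸-below S≡ n≤i)) (cong (coeff45 m n k m k) (sym (tOf≡ m n k i i≤S))))
  (λ i _ i<n → ∑-slices-m+k<t m n k _ (∸-above S≡ i<n))
  where
  S≡ : m + n + k ≡ n + (m + k)
  S≡ = regroup m n k
    where
    regroup : ∀ m n k → m + n + k ≡ n + (m + k)
    regroup = ℕ-Solver.solve-∀

partIII : ∀ m n k → k ≥ n → n ≥ m → ∀ i →
  + kpfCoeff m n k i ≡ rangeCoeff k (m + n + k) (λ j → coeff23 m n (tOf m n k j)) i
partIII m n k n≤k m≤n i = begin
  + kpfCoeff m n k i
    ≡⟨ cong +_ (sym (kpfCoeff-swap m n k i)) ⟩
  + kpfCoeff k n m i
    ≡⟨ partII k n m n≤k m≤n i ⟩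
  rangeCoeff k (k + n + m) (λ j → coeff23 m n (tOf k n m j)) i
    ≡⟨ cong (λ S → rangeCoeff k S (λ j → coeff23 m n (+ S ℤ.- + j)) i) (+-reverse₃ k n m) ⟩
  rangeCoeff k (m + n + k) (λ j → coeff23 m n (tOf m n k j)) i ∎
  where open ≡-Reasoning

coeff45-swap : ∀ m n k u v t → coeff45 k n m u v t ≡ coeff45 m n k u v t
coeff45-swap m n k u v t rewrite +-comm k m = refl

partV : ∀ m n k → n ≥ k → k ≥ m → ∀ i →
  + kpfCoeff m n k i ≡ rangeCoeff n (m + n + k) (λ j → coeff45 m n k k m (tOf m n k j)) i
partV m n k k≤n m≤k i = begin
  + kpfCoeff m n k i
    ≡⟨ cong +_ (sym (kpfCoeff-swap m n k i)) ⟩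
  + kpfCoeff k n m i
    ≡⟨ partIV k n m k≤n m≤k i ⟩
  rangeCoeff n (k + n + m) (λ j → coeff45 k n m k m (tOf k n m j)) i
    ≡⟨ cong (λ S → rangeCoeff n S (λ j → coeff45 k n m k m (+ S ℤ.- + j)) i) (+-reverse₃ k n m) ⟩
  rangeCoeff n (m + n + k) (λ j → coeff45 k n m k m (tOf m n k j)) i
    ≡⟨ cong (λ x → if (n ℕ.≤ᵇ i) ∧ (i ℕ.≤ᵇ m + n + k) then x else + 0) (coeff45-swap m n k k m (tOf m n k i)) ⟩
  rangeCoeff n (m + n + k) (λ j → coeff45 m n k k m (tOf m n k j)) i ∎
  where open ≡-Reasoning

theorem1 : (m n k : ℕ) →
    (m ≥ n → k ≥ n → ∀ i →
      + kpfCoeff m n k i ≡ rangeCoeff (m + k ∸ n) (m + n + k) (λ j → coeff1 n (tOf m n k j)) i)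
    × (m ≥ n → n ≥ k → ∀ i →
      + kpfCoeff m n k i ≡ rangeCoeff m (m + n + k) (λ j → coeff23 k n (tOf m n k j)) i)
    × (k ≥ n → n ≥ m → ∀ i →
      + kpfCoeff m n k i ≡ rangeCoeff k (m + n + k) (λ j → coeff23 m n (tOf m n k j)) i)
    × (n ≥ m → m ≥ k → ∀ i →
      + kpfCoeff m n k i ≡ rangeCoeff n (m + n + k) (λ j → coeff45 m n k m k (tOf m n k j)) i)
    × (n ≥ k → k ≥ m → ∀ i →
      + kpfCoeff m n k i ≡ rangeCoeff n (m + n + k) (λ j → coeff45 m n k k m (tOf m n k j)) i)
theorem1 m n k = partI m n k , partII m n k , partIII m n k , partIV m n k , partV m n k
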